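{- Let $r=r(n)\geq3$ and $m=m(n)$ be integers with $r^{ -2}n\leq m=o(r^{ -3}n^{3/2})$, and let $M_0^*=\bigl\lceil\log(r^{ -2}n)+\frac{3^4r^2m}{n}\bigr\rceil$. Let $\mathcal{C}$ be the set of linear $r$-graphs in $\mathcal{L}_r(n,m)$ in which every vertex has degree at most $M_0^*$. Then, as $n\to\infty$, \[ |\mathcal{C}|=\Bigl(1-O\Bigl(\frac{r^6}{n^3}\Bigr)\Bigr)|\mathcal{L}_r(n,m)|. \]
   Context: An $r$-graph on $[n]$ is a set of $r$-subsets of $[n]$ (edges); it is linear if any two distinct edges share at most one vertex. $\mathcal{L}_r(n,m)$ is the set of linear $r$-graphs on $[n]$ with $m$ edges. The degree of a vertex is the number of edges containing it. -}

module Defs where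

open import Data.Bool using (Bool; true; false; _∧_; if_then_else_)
open import Data.Nat as ℕ using (ℕ; zero; suc; _≡ᵇ_)
open import Data.Integer as ℤ using (ℤ; +_)
open import Data.Rational as ℚ using (ℚ; 0ℚ; 1ℚ; _/_)
open import Data.List using (List; []; _∷_; _++_; map; length; filterᵇ; allFin)
open import Data.Vec using (Vec; []; _∷_; lookup)
open import Data.Fin using (Fin)
open import Data.Fin.Subset using (Subset; _∩_; ∣_∣)
open import Data.Product using (_×_; ∃-syntax)
open import Relation.Nullary using (¬_)

allᵇ : {A : Set} → (A → Bool) → List A → Bool
allᵇ p []       = true
allᵇ p (x ∷ xs) = p x ∧ allᵇ p xs

allSubsets : (n : ℕ) → List (Subset n)
allSubsets zero    = [] ∷ []
allSubsets (suc n) = map (false ∷_) (allSubsets n) ++ map (true ∷_) (allSubsets n)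

sublists : {A : Set} → List A → List (List A)
sublists []       = [] ∷ []
sublists (x ∷ xs) = sublists xs ++ map (x ∷_) (sublists xs)

-- Hypergraphs on [n]: a set of edges, represented as a duplicate-free
-- list of subsets of Fin n (a sublist of allSubsets n).

uniformᵇ : {n : ℕ} → ℕ → List (Subset n) → Bool
uniformᵇ r H = allᵇ (λ e → ∣ e ∣ ≡ᵇ r) H

linearᵇ : {n : ℕ} → List (Subset n) → Bool
linearᵇ []      = true
linearᵇ (e ∷ H) = allᵇ (λ f → ∣ e ∩ f ∣ ℕ.≤ᵇ 1) H ∧ linearᵇ H

degree : {n : ℕ} → Fin n → List (Subset n) → ℕ
degree v H = length (filterᵇ (λ e → lookup e v) H)

maxDegreeAtMostᵇ : {n : ℕ} → ℤ → List (Subset n) → Bool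
maxDegreeAtMostᵇ {n} D H = allᵇ (λ v → (+ degree v H) ℤ.≤ᵇ D) (allFin n)

LinearGraphs : (r n m : ℕ) → List (List (Subset n))
LinearGraphs r n m =
  filterᵇ (λ H → uniformᵇ r H ∧ ((length H ≡ᵇ m) ∧ linearᵇ H)) (sublists (allSubsets n))

numL : (r n m : ℕ) → ℕ
numL r n m = length (LinearGraphs r n m)

numC : (r n m : ℕ) → ℤ → ℕ
numC r n m D = length (filterᵇ (maxDegreeAtMostᵇ D) (LinearGraphs r n m))

-- p / q as a rational (only used with q ≥ 1; junk value 0 when q = 0)
frac : ℕ → ℕ → ℚ
frac p zero    = 0ℚ
frac p (suc q) = (+ p) / suc q

ℕtoℚ : ℕ → ℚ
ℕtoℚ k = (+ k) / 1

ℤtoℚ : ℤ → ℚ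
ℤtoℚ z = z / 1

_^ℚ_ : ℚ → ℕ → ℚ
x ^ℚ zero  = 1ℚ
x ^ℚ suc k = x ℚ.* (x ^ℚ k)

-- ExpLt t a  ⟺  e^t < a   (for rationals t, a).
-- For integers N ≥ 1 with N > t, (N/(N-t))^N ≥ e^t and these upper
-- bounds decrease to e^t as N → ∞; so e^t < a iff some such bound is < a.
-- (N/(N-t))^N < a is written without division as N^N < a·(N-t)^N.
ExpLt : ℚ → ℚ → Set
ExpLt t a = ∃[ N ] ((1 ℕ.≤ N) × (t ℚ.< ℕtoℚ N)
              × ((ℕtoℚ N ^ℚ N) ℚ.< a ℚ.* ((ℕtoℚ N ℚ.- t) ^ℚ N)))

-- IsCeilLogPlus a b M  ⟺  M = ⌈ log a + b ⌉   (natural log, a > 0),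
-- i.e.  M - 1 < log a + b ≤ M,
-- i.e.  e^(M-1-b) < a  and  ¬ (e^(M-b) < a).
IsCeilLogPlus : ℚ → ℚ → ℤ → Set
IsCeilLogPlus a b M =
  ExpLt ((ℤtoℚ M ℚ.- 1ℚ) ℚ.- b) a × ¬ ExpLt (ℤtoℚ M ℚ.- b) a

{-# OPTIONS --safe #-}

-- Fix a vertex v and let A j count the H ∈ 𝓛ᵣ(n,m) with deg v ≥ j. Removing an edge at v and
-- then inserting an arbitrary compatible r-set compares A (j+1) with A j. At most
-- m·C(r,2)·C(n-2,r-2) ≤ C(n,r)/2 of the r-sets are incompatible with a given linear graph, since
-- m r⁴ = o(n²), and so (j+1) n A (j+1) ≤ 2 r m A j. With J = ⌊81 r²m/n⌋ this is a decay by a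
-- factor at least 79r/2 per step for j + 1 ≥ J - 1. Writing M₀ = J + T, the definition of M₀ gives
-- (n/r²)⁴ ≤ 100^T because e⁴ < 100; two steps yield r⁻² and the others 100^-(T+1), whence
-- n⁴ A (M₀+1) ≤ r⁶ |𝓛ᵣ(n,m)|. Summing over the n vertices gives the theorem.

module Submission where

open import Defs
open import Algebra.Bundles using (CommutativeMonoid)
open import Algebra.Properties.CommutativeSemigroup using (x∙yz≈y∙xz; interchange)
open import Data.Bool as Bool using (Bool; true; false; _∧_)
open import Data.Bool.Properties using (∧-assoc; ∧-comm; ∧-commutativeMonoid)
open import Data.Fin using (Fin; zero; suc)
open import Data.Fin.Subset using (Subset; _∩_; ∣_∣)
open import Data.Fin.Subset.Properties using (∩-comm; ∩-idem)
open import Data.Integer as ℤ using (ℤ) renaming (+_ to pos)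
import Data.Integer.Properties as ℤ
open import Data.List using (List; []; _∷_; _++_; map; length; filterᵇ; allFin)
open import Data.List.Membership.Propositional using (_∈_)
open import Data.List.Properties using (length-tabulate)
open import Data.List.Relation.Binary.Permutation.Propositional using (_↭_; refl; prep; swap; trans)
open import Data.List.Relation.Binary.Permutation.Propositional.Properties using (↭-length)
open import Data.List.Relation.Unary.Any using (here; there)
open import Data.Nat using (ℕ; zero; suc; _+_; _*_; _∸_; _^_; _≤_; _<_; _≡ᵇ_; _≤ᵇ_; _/_; _%_; z≤n; s≤s; s≤s⁻¹; NonZero; >-nonZero)
open import Data.Nat.Combinatorics using (_C_; nCk+nC[k+1]≡[n+1]C[k+1])
open import Data.Nat.DivMod using (m≡m%n+[m/n]*n; m%n<n; m/n*n≤m)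
open import Data.Nat.Properties
open import Data.Nat.Tactic.RingSolver using (solve-∀)
open import Data.Product using (_,_; _×_; ∃-syntax)
open import Data.Rational as ℚ using (fromℚᵘ; 0ℚ)
import Data.Rational.Properties as ℚ
open import Data.Rational.Unnormalised as ℚᵘ using (mkℚᵘ; *≤*; *<*)
import Data.Rational.Unnormalised.Properties as ℚᵘ
open import Data.Vec using ([]; _∷_; lookup)
open import Relation.Binary.PropositionalEquality as ≡ using (_≡_; cong; cong₂; sym; subst; subst₂; module ≡-Reasoning)
open import Relation.Nullary using (¬_; yes; no; contradiction)

-- The constants are tied together. The target error is of order n⁻³ and the sum over vertices costs
-- a factor n, hence the fourth power of n/r². From the rational upper bounds on e^t that `ExpLt`
-- offers, the choice N = 4T gives (4/3)^(16T) in place of e^(4T). As (4/3)^16 is about 99.77, the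
-- base becomes 100, and the decay has to beat it: at r = 3 the factor 79r/2 is 118.5. The fourth
-- power leaves r⁸/n⁴, which is why two further steps at rate r are wanted to reach r⁶/n⁴. They are
-- taken below J; going down by two loses 2n ≤ 2r²m, which turns 81 into 79. The ratio of A (j+1) to
-- A j is never formed, since A j may vanish. Both counts are compared with a third one, over linear
-- graphs with m-1 edges, and every inequality stays multiplied out in ℕ.

private variable
  A B : Set
  n : ℕ

-- Rearrangements of sums, products and conjunctions

+-left-comm : ∀ a b c → a + (b + c) ≡ b + (a + c)
+-left-comm = x∙yz≈y∙xz +-commutativeSemigroup

+-interchange : ∀ a b c d → a + b + (c + d) ≡ a + c + (b + d)
+-interchange = interchange +-commutativeSemigroup

*-left-comm : ∀ a b c → a * (b * c) ≡ b * (a * c)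
*-left-comm = x∙yz≈y∙xz *-commutativeSemigroup

*-interchange : ∀ a b c d → a * b * (c * d) ≡ a * c * (b * d)
*-interchange = interchange *-commutativeSemigroup

∧-left-comm : ∀ a b c → a ∧ (b ∧ c) ≡ b ∧ (a ∧ c)
∧-left-comm = x∙yz≈y∙xz (CommutativeMonoid.commutativeSemigroup ∧-commutativeMonoid)

∧-interchange : ∀ a b c d → (a ∧ b) ∧ (c ∧ d) ≡ (a ∧ c) ∧ (b ∧ d)
∧-interchange = interchange (CommutativeMonoid.commutativeSemigroup ∧-commutativeMonoid)

-- Finite sums and indicators
∑ : (A → ℕ) → List A → ℕ
∑ f []       = 0
∑ f (x ∷ xs) = f x + ∑ f xs

𝟙 : Bool → ℕ
𝟙 true  = 1
𝟙 false = 0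

∑-cong : {f g : A → ℕ} → (∀ x → f x ≡ g x) → ∀ xs → ∑ f xs ≡ ∑ g xs
∑-cong f≡g []       = ≡.refl
∑-cong f≡g (x ∷ xs) = cong₂ _+_ (f≡g x) (∑-cong f≡g xs)

∑-mono : {f g : A → ℕ} → (∀ x → f x ≤ g x) → ∀ xs → ∑ f xs ≤ ∑ g xs
∑-mono f≤g []       = z≤n
∑-mono f≤g (x ∷ xs) = +-mono-≤ (f≤g x) (∑-mono f≤g xs)

∑-zero : {f : A → ℕ} → (∀ x → f x ≡ 0) → ∀ xs → ∑ f xs ≡ 0
∑-zero f≡0 []       = ≡.refl
∑-zero f≡0 (x ∷ xs) = cong₂ _+_ (f≡0 x) (∑-zero f≡0 xs)

∑-++ : (f : A → ℕ) → ∀ xs ys → ∑ f (xs ++ ys) ≡ ∑ f xs + ∑ f ys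
∑-++ f []       ys = ≡.refl
∑-++ f (x ∷ xs) ys = ≡.trans (cong (f x +_) (∑-++ f xs ys)) (sym (+-assoc (f x) _ _))

∑-map : (f : B → ℕ) (g : A → B) → ∀ xs → ∑ f (map g xs) ≡ ∑ (λ x → f (g x)) xs
∑-map f g []       = ≡.refl
∑-map f g (x ∷ xs) = cong (f (g x) +_) (∑-map f g xs)

∑-distrib-+ : (f g : A → ℕ) → ∀ xs → ∑ (λ x → f x + g x) xs ≡ ∑ f xs + ∑ g xs
∑-distrib-+ f g []       = ≡.refl
∑-distrib-+ f g (x ∷ xs) =
  ≡.trans (cong (f x + g x +_) (∑-distrib-+ f g xs)) (+-interchange (f x) (g x) _ _)

∑-*ˡ : (c : ℕ) (f : A → ℕ) → ∀ xs → ∑ (λ x → c * f x) xs ≡ c * ∑ f xs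
∑-*ˡ c f []       = sym (*-zeroʳ c)
∑-*ˡ c f (x ∷ xs) = ≡.trans (cong (c * f x +_) (∑-*ˡ c f xs)) (sym (*-distribˡ-+ c (f x) _))

∑-*ʳ : (f : A → ℕ) (c : ℕ) → ∀ xs → ∑ (λ x → f x * c) xs ≡ ∑ f xs * c
∑-*ʳ f c xs = ≡.trans (∑-cong (λ x → *-comm (f x) c) xs) (≡.trans (∑-*ˡ c f xs) (*-comm c _))

∑-const : (c : ℕ) (xs : List A) → ∑ (λ _ → c) xs ≡ length xs * c
∑-const c []       = ≡.refl
∑-const c (x ∷ xs) = cong (c +_) (∑-const c xs)

∑-swap : (f : A → B → ℕ) → ∀ xs ys → ∑ (λ x → ∑ (f x) ys) xs ≡ ∑ (λ y → ∑ (λ x → f x y) xs) ys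
∑-swap f []       ys = sym (∑-zero (λ _ → ≡.refl) ys)
∑-swap f (x ∷ xs) ys =
  ≡.trans (cong (∑ (f x) ys +_) (∑-swap f xs ys)) (sym (∑-distrib-+ (f x) _ ys))

∑-filterᵇ : (p : A → Bool) (f : A → ℕ) → ∀ xs → ∑ f (filterᵇ p xs) ≡ ∑ (λ x → 𝟙 (p x) * f x) xs
∑-filterᵇ p f []       = ≡.refl
∑-filterᵇ p f (x ∷ xs) with p x
... | true  = cong₂ _+_ (sym (+-identityʳ (f x))) (∑-filterᵇ p f xs)
... | false = ∑-filterᵇ p f xs

length-∑ : (xs : List A) → length xs ≡ ∑ (λ _ → 1) xs
length-∑ []       = ≡.refl
length-∑ (x ∷ xs) = cong suc (length-∑ xs)

length-filterᵇ : (p : A → Bool) → ∀ xs → length (filterᵇ p xs) ≡ ∑ (λ x → 𝟙 (p x)) xs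
length-filterᵇ p xs = ≡.trans (length-∑ (filterᵇ p xs))
  (≡.trans (∑-filterᵇ p _ xs) (∑-cong (λ x → *-identityʳ (𝟙 (p x))) xs))

𝟙-∧ : ∀ a b → 𝟙 (a ∧ b) ≡ 𝟙 a * 𝟙 b
𝟙-∧ true  b = sym (+-identityʳ (𝟙 b))
𝟙-∧ false b = ≡.refl

𝟙≤1 : ∀ b → 𝟙 b ≤ 1
𝟙≤1 true  = s≤s z≤n
𝟙≤1 false = z≤n

-- Removing an element from a sublist

-- A discrete derivative: the sum of `φ e` at H without e, over the positions e of H. The rest keeps
-- its order, so that deleting from a sublist of U leaves a sublist of U.
∂ : (A → List A → ℕ) → List A → ℕ
∂ φ []      = 0
∂ φ (x ∷ H) = φ x H + ∂ (λ e G → φ e (x ∷ G)) H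

-- Deletion is a bijection from pairs (H , e) with e a position of H to pairs (G , e) with e a
-- position of U outside G. The second sum supplies the pairs with e inside G. In the induction,
-- deleting x from `x ∷ G` matches inserting x into a G that avoids it; all other terms fall to the
-- hypothesis for `φ` or for `φ` with x prefixed.
∑∂-sublists : (φ : A → List A → ℕ) → ∀ U →
  ∑ (∂ φ) (sublists U) + ∑ (λ G → ∑ (λ e → φ e G) G) (sublists U)
    ≡ ∑ (λ G → ∑ (λ e → φ e G) U) (sublists U)
∑∂-sublists φ []      = ≡.refl
∑∂-sublists φ (x ∷ U)
  rewrite ∑-++ (∂ φ) (sublists U) (map (x ∷_) (sublists U))
        | ∑-++ (λ G → ∑ (λ e → φ e G) G) (sublists U) (map (x ∷_) (sublists U))
        | ∑-++ (λ G → φ x G + ∑ (λ e → φ e G) U) (sublists U) (map (x ∷_) (sublists U))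
        | ∑-map (∂ φ) (x ∷_) (sublists U)
        | ∑-map (λ G → ∑ (λ e → φ e G) G) (x ∷_) (sublists U)
        | ∑-map (λ G → φ x G + ∑ (λ e → φ e G) U) (x ∷_) (sublists U)
        | ∑-distrib-+ (φ x) (∂ (λ e G → φ e (x ∷ G))) (sublists U)
        | ∑-distrib-+ (λ G → φ x (x ∷ G)) (λ G → ∑ (λ e → φ e (x ∷ G)) G) (sublists U)
        | ∑-distrib-+ (φ x) (λ G → ∑ (λ e → φ e G) U) (sublists U)
        | ∑-distrib-+ (λ G → φ x (x ∷ G)) (λ G → ∑ (λ e → φ e (x ∷ G)) U) (sublists U)
        | sym (∑∂-sublists φ U)
        | sym (∑∂-sublists (λ e G → φ e (x ∷ G)) U)
  = rearrange (∑ (∂ φ) S) (∑ (φ x) S) (∑ (∂ (λ e G → φ e (x ∷ G))) S)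
      (∑ (λ G → ∑ (λ e → φ e G) G) S) (∑ (λ G → φ x (x ∷ G)) S)
      (∑ (λ G → ∑ (λ e → φ e (x ∷ G)) G) S)
  where
  S = sublists U
  rearrange : ∀ a b c d e f → a + (b + c) + (d + (e + f)) ≡ b + (a + d) + (e + (c + f))
  rearrange = solve-∀

-- Putting the deleted entry in front permutes H, so `ψ` has the same value in every term and
-- factors out. The induction swaps the deleted entry past the head x, after which x is a fixed
-- prefix inside `ψ`.
∂-symmetric : (ψ : List A → ℕ) → (∀ {H K} → H ↭ K → ψ H ≡ ψ K) → (w : A → ℕ) →
  ∀ H → ∂ (λ e G → ψ (e ∷ G) * w e) H ≡ ψ H * ∑ w H
∂-symmetric ψ inv w [] = sym (*-zeroʳ (ψ []))
∂-symmetric {A} ψ inv w (x ∷ H) = begin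
  ψ (x ∷ H) * w x + ∂ (λ e G → ψ (e ∷ x ∷ G) * w e) H
    ≡⟨ cong (ψ (x ∷ H) * w x +_) (∂-cong (λ e G → cong (_* w e) (inv (swap e x refl))) H) ⟩
  ψ (x ∷ H) * w x + ∂ (λ e G → ψ (x ∷ e ∷ G) * w e) H
    ≡⟨ cong (ψ (x ∷ H) * w x +_) (∂-symmetric (λ K → ψ (x ∷ K)) (λ p → inv (prep x p)) w H) ⟩
  ψ (x ∷ H) * w x + ψ (x ∷ H) * ∑ w H
    ≡⟨ sym (*-distribˡ-+ (ψ (x ∷ H)) (w x) (∑ w H)) ⟩
  ψ (x ∷ H) * (w x + ∑ w H) ∎
  where
  open ≡-Reasoning
  ∂-cong : {φ χ : A → List A → ℕ} → (∀ e G → φ e G ≡ χ e G) → ∀ K → ∂ φ K ≡ ∂ χ K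
  ∂-cong φ≡χ []      = ≡.refl
  ∂-cong φ≡χ (y ∷ K) = cong₂ _+_ (φ≡χ y K) (∂-cong (λ e G → φ≡χ e (y ∷ G)) K)

-- Counting the pairs (H , e) with e ∈ H by H, respectively by the sublist G = H ∖ e.
∑-delete : (ψ : List A → ℕ) → (∀ {H K} → H ↭ K → ψ H ≡ ψ K) → (w : A → ℕ) → ∀ U →
  ∑ (λ H → ψ H * ∑ w H) (sublists U) + ∑ (λ G → ∑ (λ e → ψ (e ∷ G) * w e) G) (sublists U)
    ≡ ∑ (λ G → ∑ (λ e → ψ (e ∷ G) * w e) U) (sublists U)
∑-delete ψ inv w U = ≡.trans
  (cong (_+ ∑ (λ G → ∑ (λ e → ψ (e ∷ G) * w e) G) (sublists U))
    (∑-cong (λ H → sym (∂-symmetric ψ inv w H)) (sublists U)))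
  (∑∂-sublists (λ e G → ψ (e ∷ G) * w e) U)

-- Counting subsets of given size

-- Both sides count (k+1)-subsets of an (n+1)-set with a marked point. This is what makes the
-- proportion of r-sets through a vertex equal to r/n.
absorption : ∀ n k → suc n * (n C k) ≡ suc k * (suc n C suc k)
absorption zero zero = ≡.refl
absorption zero (suc k) = sym (*-zeroʳ k)
absorption (suc n) zero rewrite sym (nCk+nC[k+1]≡[n+1]C[k+1] (suc n) 0)
  | sym (+-identityʳ (suc n C 1)) | sym (absorption n 0) = lem n
  where
  lem : ∀ n → suc (suc n) * 1 ≡ 1 * (1 + suc n * 1)
  lem = solve-∀
absorption (suc n) (suc k) = begin
  suc (suc n) * (suc n C suc k)
    ≡⟨ cong (suc n C suc k +_) (cong (suc n *_) (sym (nCk+nC[k+1]≡[n+1]C[k+1] n k))) ⟩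
  suc n C suc k + suc n * (n C k + n C suc k)
    ≡⟨ cong (suc n C suc k +_) (*-distribˡ-+ (suc n) (n C k) _) ⟩
  suc n C suc k + (suc n * (n C k) + suc n * (n C suc k))
    ≡⟨ cong (suc n C suc k +_) (cong₂ _+_ (absorption n k) (absorption n (suc k))) ⟩
  suc n C suc k + (suc k * (suc n C suc k) + suc (suc k) * (suc n C suc (suc k)))
    ≡⟨ lem k (suc n C suc k) (suc n C suc (suc k)) ⟩
  suc (suc k) * (suc n C suc k + suc n C suc (suc k))
    ≡⟨ cong (suc (suc k) *_) (nCk+nC[k+1]≡[n+1]C[k+1] (suc n) (suc k)) ⟩
  suc (suc k) * (suc (suc n) C suc (suc k)) ∎
  where
  open ≡-Reasoning
  lem : ∀ k x y → x + (suc k * x + suc (suc k) * y) ≡ suc (suc k) * (x + y)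
  lem = solve-∀

sizeᵇ : ∀ {n} → ℕ → Subset n → Bool
sizeᵇ k e = ∣ e ∣ ≡ᵇ k

∑-allSubsets : ∀ {n} (f : Subset (suc n) → ℕ) →
  ∑ f (allSubsets (suc n))
    ≡ ∑ (λ e → f (false ∷ e)) (allSubsets n) + ∑ (λ e → f (true ∷ e)) (allSubsets n)
∑-allSubsets {n} f = ≡.trans (∑-++ f (map (false ∷_) (allSubsets n)) _)
  (cong₂ _+_ (∑-map f (false ∷_) (allSubsets n)) (∑-map f (true ∷_) (allSubsets n)))

∑-size : ∀ n k → ∑ (λ e → 𝟙 (sizeᵇ k e)) (allSubsets n) ≡ n C k
∑-size zero    zero    = ≡.refl
∑-size zero    (suc k) = ≡.refl
∑-size (suc n) zero    = ≡.trans (∑-allSubsets {n} (λ e → 𝟙 (sizeᵇ 0 e)))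
  (cong₂ _+_ (∑-size n 0) (∑-zero (λ _ → ≡.refl) (allSubsets n)))
∑-size (suc n) (suc k) = ≡.trans (∑-allSubsets {n} (λ e → 𝟙 (sizeᵇ (suc k) e)))
  (≡.trans (cong₂ _+_ (∑-size n (suc k)) (∑-size n k))
    (≡.trans (+-comm (n C suc k) _) (nCk+nC[k+1]≡[n+1]C[k+1] n k)))

-- The number of k-subsets of [n] through one, respectively two, given points.
through₁ through₂ : ℕ → ℕ → ℕ
through₁ (suc n) (suc k) = n C k
through₁ _       _       = 0
through₂ (suc n) (suc k) = through₁ n k
through₂ _       _       = 0

through₁-pascal : ∀ n k → through₁ (suc n) (suc k) + through₁ (suc n) k ≡ suc n C k
through₁-pascal n zero    = ≡.refl
through₁-pascal n (suc k) = ≡.trans (+-comm (n C suc k) _) (nCk+nC[k+1]≡[n+1]C[k+1] n k)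

∑-size-∋ : ∀ {n} (v : Fin n) k →
  ∑ (λ e → 𝟙 (sizeᵇ k e) * 𝟙 (lookup e v)) (allSubsets n) ≡ through₁ n k
∑-size-∋ {suc n} zero zero = ≡.trans
  (∑-allSubsets {n} (λ e → 𝟙 (sizeᵇ 0 e) * 𝟙 (lookup e zero)))
  (cong₂ _+_ (∑-zero (λ e → *-zeroʳ (𝟙 (sizeᵇ 0 e))) (allSubsets n))
             (∑-zero (λ _ → ≡.refl) (allSubsets n)))
∑-size-∋ {suc n} zero (suc k) = ≡.trans
  (∑-allSubsets {n} (λ e → 𝟙 (sizeᵇ (suc k) e) * 𝟙 (lookup e zero)))
  (cong₂ _+_ (∑-zero (λ e → *-zeroʳ (𝟙 (sizeᵇ (suc k) e))) (allSubsets n))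
             (≡.trans (∑-cong (λ e → *-identityʳ (𝟙 (sizeᵇ k e))) (allSubsets n)) (∑-size n k)))
∑-size-∋ {suc n} (suc v) zero = ≡.trans
  (∑-allSubsets {n} (λ e → 𝟙 (sizeᵇ 0 e) * 𝟙 (lookup e (suc v))))
  (cong₂ _+_ (≡.trans (∑-size-∋ v 0) (through₁-0 n)) (∑-zero (λ _ → ≡.refl) (allSubsets n)))
  where
  through₁-0 : ∀ n → through₁ n 0 ≡ 0
  through₁-0 zero    = ≡.refl
  through₁-0 (suc n) = ≡.refl
∑-size-∋ {suc (suc n)} (suc v) (suc k) = ≡.trans
  (∑-allSubsets {suc n} (λ e → 𝟙 (sizeᵇ (suc k) e) * 𝟙 (lookup e (suc v))))
  (≡.trans (cong₂ _+_ (∑-size-∋ v (suc k)) (∑-size-∋ v k)) (through₁-pascal n k))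

-- Double counting of the pairs of a k-set and a point that it shares with f.
∑-size-∩ : ∀ {n} (f : Subset n) k →
  ∑ (λ e → 𝟙 (sizeᵇ k e) * ∣ e ∩ f ∣) (allSubsets n) ≡ ∣ f ∣ * through₁ n k
∑-size-∩ [] k = ≡.trans (+-identityʳ _) (*-zeroʳ (𝟙 (sizeᵇ k [])))
∑-size-∩ {suc n} (x ∷ f) zero = ≡.trans
  (∑-allSubsets (λ e → 𝟙 (sizeᵇ 0 e) * ∣ e ∩ (x ∷ f) ∣))
  (≡.trans (cong₂ _+_ (≡.trans (∑-size-∩ f 0) (vanish n)) (∑-zero (λ _ → ≡.refl) (allSubsets n)))
           (sym (*-zeroʳ ∣ x ∷ f ∣)))
  where
  vanish : ∀ n → ∣ f ∣ * through₁ n 0 ≡ 0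
  vanish zero    = *-zeroʳ ∣ f ∣
  vanish (suc n) = *-zeroʳ ∣ f ∣
∑-size-∩ {suc n} (x ∷ f) (suc k) = ≡.trans
  (∑-allSubsets (λ e → 𝟙 (sizeᵇ (suc k) e) * ∣ e ∩ (x ∷ f) ∣)) (head x)
  where
  pascal : ∀ {n} (f : Subset n) → ∣ f ∣ * through₁ n (suc k) + ∣ f ∣ * through₁ n k ≡ ∣ f ∣ * (n C k)
  pascal []             = ≡.refl
  pascal {suc n} f@(_ ∷ _) =
    ≡.trans (sym (*-distribˡ-+ ∣ f ∣ (n C k) _)) (cong (∣ f ∣ *_) (through₁-pascal n k))
  head : ∀ x → ∑ (λ e → 𝟙 (sizeᵇ (suc k) e) * ∣ e ∩ f ∣) (allSubsets n)
               + ∑ (λ e → 𝟙 (sizeᵇ k e) * ∣ (true ∷ e) ∩ (x ∷ f) ∣) (allSubsets n)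
             ≡ ∣ x ∷ f ∣ * (n C k)
  head false = ≡.trans (cong₂ _+_ (∑-size-∩ f (suc k)) (∑-size-∩ f k)) (pascal f)
  head true  = begin
    ∑ (λ e → 𝟙 (sizeᵇ (suc k) e) * ∣ e ∩ f ∣) (allSubsets n)
      + ∑ (λ e → 𝟙 (sizeᵇ k e) * suc ∣ e ∩ f ∣) (allSubsets n)
      ≡⟨ cong₂ _+_ (∑-size-∩ f (suc k))
           (≡.trans (∑-cong (λ e → *-suc (𝟙 (sizeᵇ k e)) _) (allSubsets n))
             (≡.trans (∑-distrib-+ (λ e → 𝟙 (sizeᵇ k e)) _ (allSubsets n))
               (cong₂ _+_ (∑-size n k) (∑-size-∩ f k)))) ⟩
    ∣ f ∣ * through₁ n (suc k) + (n C k + ∣ f ∣ * through₁ n k)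
      ≡⟨ +-left-comm (∣ f ∣ * through₁ n (suc k)) (n C k) _ ⟩
    n C k + (∣ f ∣ * through₁ n (suc k) + ∣ f ∣ * through₁ n k)
      ≡⟨ cong (n C k +_) (pascal f) ⟩
    n C k + ∣ f ∣ * (n C k) ∎
    where
    open ≡-Reasoning

-- The binomial coefficient k choose 2. The recursion fits induction on subsets: a new common point
-- forms a pair with each earlier one.
pairs : ℕ → ℕ
pairs zero    = 0
pairs (suc k) = k + pairs k

-- Double counting again, now of k-sets with a pair of points shared with f. When the first point
-- lies in both sets, the pairs using it are counted by `∑-size-∩`.
∑-size-pairs : ∀ {n} (f : Subset n) k →
  ∑ (λ e → 𝟙 (sizeᵇ k e) * pairs ∣ e ∩ f ∣) (allSubsets n) ≡ pairs ∣ f ∣ * through₂ n k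
∑-size-pairs [] k = ≡.trans (+-identityʳ _) (*-zeroʳ (𝟙 (sizeᵇ k [])))
∑-size-pairs {suc n} (x ∷ f) zero = ≡.trans
  (∑-allSubsets (λ e → 𝟙 (sizeᵇ 0 e) * pairs ∣ e ∩ (x ∷ f) ∣))
  (≡.trans (cong₂ _+_ (≡.trans (∑-size-pairs f 0) (vanish n)) (∑-zero (λ _ → ≡.refl) (allSubsets n)))
           (sym (*-zeroʳ (pairs ∣ x ∷ f ∣))))
  where
  vanish : ∀ n → pairs ∣ f ∣ * through₂ n 0 ≡ 0
  vanish zero    = *-zeroʳ (pairs ∣ f ∣)
  vanish (suc n) = *-zeroʳ (pairs ∣ f ∣)
∑-size-pairs {suc n} (x ∷ f) (suc k) = ≡.trans
  (∑-allSubsets (λ e → 𝟙 (sizeᵇ (suc k) e) * pairs ∣ e ∩ (x ∷ f) ∣)) (head x)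
  where
  pascal : ∀ {n} (f : Subset n) k →
    pairs ∣ f ∣ * through₂ n (suc k) + pairs ∣ f ∣ * through₂ n k ≡ pairs ∣ f ∣ * through₁ n k
  pascal []             k       = ≡.refl
  pascal {suc n} f@(_ ∷ _) zero = ≡.trans
    (sym (*-distribˡ-+ (pairs ∣ f ∣) (through₁ n 0) 0)) (cong (pairs ∣ f ∣ *_) (through₁-0 n))
    where
    through₁-0 : ∀ n → through₁ n 0 + 0 ≡ 0
    through₁-0 zero    = ≡.refl
    through₁-0 (suc n) = ≡.refl
  pascal (false ∷ [])   (suc k) = ≡.refl
  pascal (true ∷ [])    (suc k) = ≡.refl
  pascal {suc (suc n)} f@(_ ∷ _ ∷ _) (suc k) = ≡.trans
    (sym (*-distribˡ-+ (pairs ∣ f ∣) (n C k) _)) (cong (pairs ∣ f ∣ *_) (through₁-pascal n k))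
  head : ∀ x → ∑ (λ e → 𝟙 (sizeᵇ (suc k) e) * pairs ∣ e ∩ f ∣) (allSubsets n)
               + ∑ (λ e → 𝟙 (sizeᵇ k e) * pairs ∣ (true ∷ e) ∩ (x ∷ f) ∣) (allSubsets n)
             ≡ pairs ∣ x ∷ f ∣ * through₁ n k
  head false = ≡.trans (cong₂ _+_ (∑-size-pairs f (suc k)) (∑-size-pairs f k)) (pascal f k)
  head true  = begin
    ∑ (λ e → 𝟙 (sizeᵇ (suc k) e) * pairs ∣ e ∩ f ∣) (allSubsets n)
      + ∑ (λ e → 𝟙 (sizeᵇ k e) * (∣ e ∩ f ∣ + pairs ∣ e ∩ f ∣)) (allSubsets n)
      ≡⟨ cong₂ _+_ (∑-size-pairs f (suc k))
           (≡.trans (∑-cong (λ e → *-distribˡ-+ (𝟙 (sizeᵇ k e)) ∣ e ∩ f ∣ _) (allSubsets n))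
             (≡.trans (∑-distrib-+ (λ e → 𝟙 (sizeᵇ k e) * ∣ e ∩ f ∣) _ (allSubsets n))
               (cong₂ _+_ (∑-size-∩ f k) (∑-size-pairs f k)))) ⟩
    pairs ∣ f ∣ * through₂ n (suc k) + (∣ f ∣ * through₁ n k + pairs ∣ f ∣ * through₂ n k)
      ≡⟨ +-left-comm (pairs ∣ f ∣ * through₂ n (suc k)) (∣ f ∣ * through₁ n k) _ ⟩
    ∣ f ∣ * through₁ n k + (pairs ∣ f ∣ * through₂ n (suc k) + pairs ∣ f ∣ * through₂ n k)
      ≡⟨ cong (∣ f ∣ * through₁ n k +_) (pascal f k) ⟩
    ∣ f ∣ * through₁ n k + pairs ∣ f ∣ * through₁ n k
      ≡⟨ sym (*-distribʳ-+ (through₁ n k) ∣ f ∣ _) ⟩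
    (∣ f ∣ + pairs ∣ f ∣) * through₁ n k ∎
    where
    open ≡-Reasoning

-- Switching one edge

allᵇ-↭ : (p : A → Bool) → ∀ {H K} → H ↭ K → allᵇ p H ≡ allᵇ p K
allᵇ-↭ p refl           = ≡.refl
allᵇ-↭ p (prep x H↭K)   = cong (p x ∧_) (allᵇ-↭ p H↭K)
allᵇ-↭ p (swap x y H↭K) =
  ≡.trans (∧-left-comm (p x) (p y) _) (cong (λ b → p y ∧ (p x ∧ b)) (allᵇ-↭ p H↭K))
allᵇ-↭ p (trans H↭K K↭L) = ≡.trans (allᵇ-↭ p H↭K) (allᵇ-↭ p K↭L)

meetᵇ : Subset n → Subset n → Bool
meetᵇ e f = ∣ e ∩ f ∣ ≤ᵇ 1

linearᵇ-↭ : {H K : List (Subset n)} → H ↭ K → linearᵇ H ≡ linearᵇ K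
linearᵇ-↭ refl           = ≡.refl
linearᵇ-↭ (prep x H↭K)   = cong₂ _∧_ (allᵇ-↭ (meetᵇ x) H↭K) (linearᵇ-↭ H↭K)
linearᵇ-↭ (swap {K} {L} x y H↭K)
  rewrite ∩-comm x y | allᵇ-↭ (meetᵇ x) H↭K | allᵇ-↭ (meetᵇ y) H↭K | linearᵇ-↭ H↭K =
  ∧-interchange (meetᵇ y x) (allᵇ (meetᵇ x) L) (allᵇ (meetᵇ y) L) (linearᵇ L)
linearᵇ-↭ (trans H↭K K↭L) = ≡.trans (linearᵇ-↭ H↭K) (linearᵇ-↭ K↭L)

degree-∑ : (v : Fin n) → ∀ H → degree v H ≡ ∑ (λ e → 𝟙 (lookup e v)) H
degree-∑ v H = length-filterᵇ (λ e → lookup e v) H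

∑-↭ : (f : A → ℕ) → ∀ {H K} → H ↭ K → ∑ f H ≡ ∑ f K
∑-↭ f refl            = ≡.refl
∑-↭ f (prep x H↭K)    = cong (f x +_) (∑-↭ f H↭K)
∑-↭ f (swap x y H↭K)  =
  ≡.trans (+-left-comm (f x) (f y) _) (cong (λ s → f y + (f x + s)) (∑-↭ f H↭K))
∑-↭ f (trans H↭K K↭L) = ≡.trans (∑-↭ f H↭K) (∑-↭ f K↭L)

degree-↭ : (v : Fin n) → ∀ {H K} → H ↭ K → degree v H ≡ degree v K
degree-↭ v {H} {K} H↭K =
  ≡.trans (degree-∑ v H) (≡.trans (∑-↭ (λ e → 𝟙 (lookup e v)) H↭K) (sym (degree-∑ v K)))

degree-∷ : (v : Fin n) (e : Subset n) → ∀ H → degree v (e ∷ H) ≡ 𝟙 (lookup e v) + degree v H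
degree-∷ v e H = ≡.trans (degree-∑ v (e ∷ H)) (cong (𝟙 (lookup e v) +_) (sym (degree-∑ v H)))

-- Membership in 𝓛ᵣ(n,m) and in 𝓛ᵣ(n,m-1), the latter read as empty when m = 0.
inLᵇ inL⁻ᵇ : ℕ → ℕ → List (Subset n) → Bool
inLᵇ r m H     = uniformᵇ r H ∧ ((length H ≡ᵇ m) ∧ linearᵇ H)
inL⁻ᵇ r m G = uniformᵇ r G ∧ ((suc (length G) ≡ᵇ m) ∧ linearᵇ G)

inLᵇ-↭ : ∀ r m {H K : List (Subset n)} → H ↭ K → inLᵇ r m H ≡ inLᵇ r m K
inLᵇ-↭ r m H↭K = cong₂ _∧_ (allᵇ-↭ _ H↭K)
  (cong₂ _∧_ (cong (_≡ᵇ m) (↭-length H↭K)) (linearᵇ-↭ H↭K))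

-- Separates what depends on G alone from the compatibility of e with G, so that for fixed G the sum
-- over all e acts on the second factor only.
𝟙-inLᵇ-∷ : ∀ r m (e : Subset n) G →
  𝟙 (inLᵇ r m (e ∷ G)) ≡ 𝟙 (inL⁻ᵇ r m G) * (𝟙 (sizeᵇ r e) * 𝟙 (allᵇ (meetᵇ e) G))
𝟙-inLᵇ-∷ r m e G = split (sizeᵇ r e) (uniformᵇ r G) (suc (length G) ≡ᵇ m) (allᵇ (meetᵇ e) G) (linearᵇ G)
  where
  split : ∀ a b c d f → 𝟙 ((a ∧ b) ∧ (c ∧ (d ∧ f))) ≡ 𝟙 (b ∧ (c ∧ f)) * (𝟙 a * 𝟙 d)
  split a     false c     d     f = cong 𝟙 (≡.trans (∧-assoc a false _) (∧-comm a false))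
  split false true  c     d     f = sym (*-zeroʳ (𝟙 (c ∧ f)))
  split true  true  false d     f = ≡.refl
  split true  true  true  false f = sym (*-zeroʳ (𝟙 f))
  split true  true  true  true  f = sym (*-identityʳ (𝟙 f))

≤ᵇ-mono : ∀ j {a b} → a ≤ b → 𝟙 (j ≤ᵇ a) ≤ 𝟙 (j ≤ᵇ b)
≤ᵇ-mono j {a} {b} a≤b with j ≤ᵇ a in eq
... | false = z≤n
... | true with j ≤ᵇ b | ≤⇒≤ᵇ (≤-trans (≤ᵇ⇒≤ j a (subst Bool.T (sym eq) _)) a≤b)
...   | true | _ = ≤-refl

heavy : ℕ → ℕ → Fin n → ℕ → List (Subset n) → ℕ
heavy r m v j H = 𝟙 (inLᵇ r m H) * 𝟙 (j ≤ᵇ degree v H)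

heavy⁻ : ℕ → ℕ → Fin n → ℕ → List (Subset n) → ℕ
heavy⁻ r m v j G = 𝟙 (inL⁻ᵇ r m G) * 𝟙 (j ≤ᵇ degree v G)

-- `numHeavy r m v j` is A j; `numHeavy⁻` is the intermediate count, with one edge fewer, that links
-- A (i+1) to A i.
numHeavy numHeavy⁻ : ℕ → ℕ → Fin n → ℕ → ℕ
numHeavy {n} r m v j      = ∑ (heavy r m v j) (sublists (allSubsets n))
numHeavy⁻ {n} r m v j = ∑ (heavy⁻ r m v j) (sublists (allSubsets n))

heavy-↭ : ∀ r m (v : Fin n) j {H K} → H ↭ K → heavy r m v j H ≡ heavy r m v j K
heavy-↭ r m v j H↭K = cong₂ _*_ (cong 𝟙 (inLᵇ-↭ r m H↭K)) (cong (λ d → 𝟙 (j ≤ᵇ d)) (degree-↭ v H↭K))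

𝟙-≤ᵇ-* : ∀ j d → j * 𝟙 (j ≤ᵇ d) ≤ 𝟙 (j ≤ᵇ d) * d
𝟙-≤ᵇ-* j d with j ≤ᵇ d in eq
... | false = ≤-reflexive (*-zeroʳ j)
... | true  = ≤-trans (≤-reflexive (*-identityʳ j))
  (≤-trans (≤ᵇ⇒≤ j d (subst Bool.T (sym eq) _)) (≤-reflexive (sym (+-identityʳ d))))

-- A graph with degree at least i+1 at v offers at least i+1 edges at v to delete, and the degree
-- stays at least i. Conversely, a given smaller graph arises from at most as many graphs as there
-- are r-sets through v.
heavy-edge-removal : ∀ r m (v : Fin n) i →
  suc i * numHeavy r m v (suc i) ≤ numHeavy⁻ r m v i * through₁ n r
heavy-edge-removal {n} r m v i = begin
  suc i * ∑ ψ S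
    ≡⟨ sym (∑-*ˡ (suc i) ψ S) ⟩
  ∑ (λ H → suc i * ψ H) S
    ≤⟨ ∑-mono incidences S ⟩
  ∑ (λ H → ψ H * ∑ w H) S
    -- Adding the pairs with e already in G completes the inner sum to all subsets; only an upper
    -- bound is sought.
    ≤⟨ m≤m+n _ _ ⟩
  ∑ (λ H → ψ H * ∑ w H) S + ∑ (λ G → ∑ (λ e → ψ (e ∷ G) * w e) G) S
    ≡⟨ ∑-delete ψ (heavy-↭ r m v (suc i)) w (allSubsets n) ⟩
  ∑ (λ G → ∑ (λ e → ψ (e ∷ G) * w e) (allSubsets n)) S
    ≤⟨ ∑-mono (λ G → ∑-mono (insertion G) (allSubsets n)) S ⟩
  ∑ (λ G → ∑ (λ e → heavy⁻ r m v i G * (𝟙 (sizeᵇ r e) * w e)) (allSubsets n)) S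
    ≡⟨ ∑-cong (λ G → ≡.trans (∑-*ˡ (heavy⁻ r m v i G) _ (allSubsets n))
                       (cong (heavy⁻ r m v i G *_) (∑-size-∋ v r))) S ⟩
  ∑ (λ G → heavy⁻ r m v i G * through₁ n r) S
    ≡⟨ ∑-*ʳ (heavy⁻ r m v i) (through₁ n r) S ⟩
  numHeavy⁻ r m v i * through₁ n r ∎
  where
  open ≤-Reasoning
  S = sublists (allSubsets n)
  ψ = heavy r m v (suc i)
  w : Subset n → ℕ
  w e = 𝟙 (lookup e v)
  incidences : ∀ H → suc i * ψ H ≤ ψ H * ∑ w H
  incidences H = begin
    suc i * (𝟙 (inLᵇ r m H) * 𝟙 (suc i ≤ᵇ degree v H))
      ≡⟨ *-left-comm (suc i) (𝟙 (inLᵇ r m H)) _ ⟩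
    𝟙 (inLᵇ r m H) * (suc i * 𝟙 (suc i ≤ᵇ degree v H))
      ≤⟨ *-monoʳ-≤ (𝟙 (inLᵇ r m H)) (𝟙-≤ᵇ-* (suc i) (degree v H)) ⟩
    𝟙 (inLᵇ r m H) * (𝟙 (suc i ≤ᵇ degree v H) * degree v H)
      ≡⟨ sym (*-assoc (𝟙 (inLᵇ r m H)) _ _) ⟩
    ψ H * degree v H
      ≡⟨ cong (ψ H *_) (degree-∑ v H) ⟩
    ψ H * ∑ w H ∎
  insertion : ∀ G e → ψ (e ∷ G) * w e ≤ heavy⁻ r m v i G * (𝟙 (sizeᵇ r e) * w e)
  insertion G e = begin
    𝟙 (inLᵇ r m (e ∷ G)) * 𝟙 (suc i ≤ᵇ degree v (e ∷ G)) * w e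
      ≡⟨ cong (λ x → x * 𝟙 (suc i ≤ᵇ degree v (e ∷ G)) * w e) (𝟙-inLᵇ-∷ r m e G) ⟩
    L * (s * 𝟙 (allᵇ (meetᵇ e) G)) * 𝟙 (suc i ≤ᵇ degree v (e ∷ G)) * w e
      ≤⟨ *-monoˡ-≤ (w e) (*-mono-≤ (*-monoʳ-≤ L (*-monoʳ-≤ s (𝟙≤1 _))) drop-edge) ⟩
    L * (s * 1) * 𝟙 (i ≤ᵇ degree v G) * w e
      ≡⟨ lem L s _ (w e) ⟩
    L * 𝟙 (i ≤ᵇ degree v G) * (s * w e) ∎
    where
    L = 𝟙 (inL⁻ᵇ r m G)
    s = 𝟙 (sizeᵇ r e)
    lem : ∀ a b c d → a * (b * 1) * c * d ≡ a * c * (b * d)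
    lem = solve-∀
    ≤ᵇ-pred : ∀ i d → 𝟙 (suc i ≤ᵇ suc d) ≤ 𝟙 (i ≤ᵇ d)
    ≤ᵇ-pred zero    d = ≤-refl
    ≤ᵇ-pred (suc i) d = ≤-refl
    drop-edge : 𝟙 (suc i ≤ᵇ degree v (e ∷ G)) ≤ 𝟙 (i ≤ᵇ degree v G)
    drop-edge = ≤-trans
      (≤ᵇ-mono (suc i) (≤-trans (≤-reflexive (degree-∷ v e G)) (+-monoˡ-≤ (degree v G) (𝟙≤1 (lookup e v)))))
      (≤ᵇ-pred i (degree v G))

-- A member e of G meets itself in r ≥ 2 points, so e ∷ G is never linear.
heavy-repeated : ∀ r m (v : Fin n) j → 2 ≤ r → ∀ G → ∑ (λ e → heavy r m v j (e ∷ G) * 1) G ≡ 0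
heavy-repeated {n} r m v j 2≤r G = members G repeated
  where
  members : ∀ {f : Subset n → ℕ} K → (∀ e → e ∈ K → f e ≡ 0) → ∑ f K ≡ 0
  members []      h = ≡.refl
  members (x ∷ K) h = cong₂ _+_ (h x (here ≡.refl)) (members K (λ e p → h e (there p)))
  ≰1 : ∀ {k} → 2 ≤ k → (k ≤ᵇ 1) ≡ false
  ≰1 (s≤s (s≤s _)) = ≡.refl
  selfMeet : ∀ (e : Subset n) {K} → e ∈ K → 𝟙 (sizeᵇ r e) * 𝟙 (allᵇ (meetᵇ e) K) ≡ 0
  selfMeet e (there {x} p) with meetᵇ e x
  ... | true  = selfMeet e p
  ... | false = *-zeroʳ (𝟙 (sizeᵇ r e))
  selfMeet e (here ≡.refl) rewrite ∩-idem e with sizeᵇ r e in eq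
  ... | false = ≡.refl
  ... | true rewrite ≡ᵇ⇒≡ ∣ e ∣ r (subst Bool.T (sym eq) _) | ≰1 2≤r = ≡.refl
  repeated : ∀ e → e ∈ G → heavy r m v j (e ∷ G) * 1 ≡ 0
  repeated e p rewrite 𝟙-inLᵇ-∷ r m e G | selfMeet e p | *-zeroʳ (𝟙 (inL⁻ᵇ r m G)) = ≡.refl

-- Counting the r-sets compatible with a given graph

∑-pairs-uniform : ∀ r (G : List (Subset n)) → uniformᵇ r G ≡ true →
  ∑ (λ f → pairs ∣ f ∣) G ≡ length G * pairs r
∑-pairs-uniform r []      _ = ≡.refl
∑-pairs-uniform r (f ∷ G) u with sizeᵇ r f in eq
... | true = cong₂ _+_ (cong pairs (≡ᵇ⇒≡ ∣ f ∣ r (subst Bool.T (sym eq) _))) (∑-pairs-uniform r G u)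

-- An incompatible e shares two points with some member of G, and `pairs` is positive from 2 on.
free-or-pair : ∀ (e : Subset n) G → 1 ≤ 𝟙 (allᵇ (meetᵇ e) G) + ∑ (λ f → pairs ∣ e ∩ f ∣) G
free-or-pair e []      = ≤-refl
free-or-pair e (f ∷ G) with ∣ e ∩ f ∣
... | 0           = free-or-pair e G
... | 1           = free-or-pair e G
... | suc (suc k) = s≤s z≤n

-- A first-moment bound: the incompatible r-sets are at most the shared pairs, summed over the edges
-- of G and over all r-sets.
free-count : ∀ r (G : List (Subset n)) → uniformᵇ r G ≡ true →
  n C r ≤ ∑ (λ e → 𝟙 (sizeᵇ r e) * 𝟙 (allᵇ (meetᵇ e) G)) (allSubsets n)
            + length G * (pairs r * through₂ n r)
free-count {n} r G u = begin
  n C r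
    ≡⟨ sym (∑-size n r) ⟩
  ∑ (λ e → 𝟙 (sizeᵇ r e)) U
    ≤⟨ ∑-mono pointwise U ⟩
  ∑ (λ e → free e + ∑ (λ f → 𝟙 (sizeᵇ r e) * pairs ∣ e ∩ f ∣) G) U
    ≡⟨ ∑-distrib-+ free _ U ⟩
  ∑ free U + ∑ (λ e → ∑ (λ f → 𝟙 (sizeᵇ r e) * pairs ∣ e ∩ f ∣) G) U
    ≡⟨ cong (∑ free U +_) (∑-swap (λ e f → 𝟙 (sizeᵇ r e) * pairs ∣ e ∩ f ∣) U G) ⟩
  ∑ free U + ∑ (λ f → ∑ (λ e → 𝟙 (sizeᵇ r e) * pairs ∣ e ∩ f ∣) U) G
    ≡⟨ cong (∑ free U +_) (∑-cong (λ f → ∑-size-pairs f r) G) ⟩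
  ∑ free U + ∑ (λ f → pairs ∣ f ∣ * through₂ n r) G
    ≡⟨ cong (∑ free U +_) (∑-*ʳ (λ f → pairs ∣ f ∣) (through₂ n r) G) ⟩
  ∑ free U + ∑ (λ f → pairs ∣ f ∣) G * through₂ n r
    ≡⟨ cong (λ x → ∑ free U + x * through₂ n r) (∑-pairs-uniform r G u) ⟩
  ∑ free U + length G * pairs r * through₂ n r
    ≡⟨ cong (∑ free U +_) (*-assoc (length G) (pairs r) _) ⟩
  ∑ free U + length G * (pairs r * through₂ n r) ∎
  where
  open ≤-Reasoning
  U = allSubsets n
  free : Subset n → ℕ
  free e = 𝟙 (sizeᵇ r e) * 𝟙 (allᵇ (meetᵇ e) G)
  pointwise : ∀ e → 𝟙 (sizeᵇ r e) ≤ free e + ∑ (λ f → 𝟙 (sizeᵇ r e) * pairs ∣ e ∩ f ∣) G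
  pointwise e = begin
    𝟙 (sizeᵇ r e)
      ≡⟨ sym (*-identityʳ _) ⟩
    𝟙 (sizeᵇ r e) * 1
      ≤⟨ *-monoʳ-≤ (𝟙 (sizeᵇ r e)) (free-or-pair e G) ⟩
    𝟙 (sizeᵇ r e) * (𝟙 (allᵇ (meetᵇ e) G) + ∑ (λ f → pairs ∣ e ∩ f ∣) G)
      ≡⟨ *-distribˡ-+ (𝟙 (sizeᵇ r e)) (𝟙 (allᵇ (meetᵇ e) G)) _ ⟩
    free e + 𝟙 (sizeᵇ r e) * ∑ (λ f → pairs ∣ e ∩ f ∣) G
      ≡⟨ cong (free e +_) (sym (∑-*ˡ (𝟙 (sizeᵇ r e)) _ G)) ⟩
    free e + ∑ (λ f → 𝟙 (sizeᵇ r e) * pairs ∣ e ∩ f ∣) G ∎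

lower-free-count : ∀ r m → 2 * (m * (pairs r * through₂ n r)) ≤ n C r → (G : List (Subset n)) →
  𝟙 (inL⁻ᵇ r m G) * (n C r)
    ≤ 2 * (𝟙 (inL⁻ᵇ r m G) * ∑ (λ e → 𝟙 (sizeᵇ r e) * 𝟙 (allᵇ (meetᵇ e) G)) (allSubsets n))
lower-free-count {n} r m sparse G with uniformᵇ r G in uni | suc (length G) ≡ᵇ m in len | linearᵇ G
... | false | _     | _     = z≤n
... | true  | false | _     = z≤n
... | true  | true  | false = z≤n
... | true  | true  | true  = ≤-trans (≤-reflexive (+-identityʳ (n C r)))
  (≤-trans half (≤-reflexive (cong (2 *_) (sym (+-identityʳ F)))))
  where
  open ≤-Reasoning
  F = ∑ (λ e → 𝟙 (sizeᵇ r e) * 𝟙 (allᵇ (meetᵇ e) G)) (allSubsets n)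
  X = pairs r * through₂ n r
  length≤m : length G ≤ m
  length≤m = ≤-trans (n≤1+n _) (≤-reflexive (≡ᵇ⇒≡ (suc (length G)) m (subst Bool.T (sym len) _)))
  half : n C r ≤ 2 * F
  -- With B an upper bound for the incompatible sets, C ≤ F + B and 2B ≤ C give 2C ≤ 2F + C.
  half = +-cancelʳ-≤ (n C r) (n C r) (2 * F) (begin
    n C r + n C r                ≡⟨ lem (n C r) ⟩
    2 * (n C r)                  ≤⟨ *-monoʳ-≤ 2 (free-count r G uni) ⟩
    2 * (F + length G * X)       ≡⟨ *-distribˡ-+ 2 F _ ⟩
    2 * F + 2 * (length G * X)   ≤⟨ +-monoʳ-≤ (2 * F) (*-monoʳ-≤ 2 (*-monoˡ-≤ X length≤m)) ⟩
    2 * F + 2 * (m * X)          ≤⟨ +-monoʳ-≤ (2 * F) sparse ⟩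
    2 * F + n C r                ∎)
    where
    lem : ∀ x → x + x ≡ 2 * x
    lem = solve-∀

-- At least half of all r-sets can be inserted into each smaller graph, and each graph with m edges
-- is reached once for each of its edges, hence m times.
heavy-edge-insertion : ∀ r m (v : Fin n) i → 2 ≤ r → 2 * (m * (pairs r * through₂ n r)) ≤ n C r →
  numHeavy⁻ r m v i * (n C r) ≤ 2 * (m * numHeavy r m v i)
heavy-edge-insertion {n} r m v i 2≤r sparse = begin
  ∑ (heavy⁻ r m v i) S * (n C r)
    ≡⟨ sym (∑-*ʳ (heavy⁻ r m v i) (n C r) S) ⟩
  ∑ (λ G → heavy⁻ r m v i G * (n C r)) S
    ≤⟨ ∑-mono insertions S ⟩
  ∑ (λ G → 2 * ∑ (λ e → ψ (e ∷ G) * 1) U) S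
    ≡⟨ ∑-*ˡ 2 (λ G → ∑ (λ e → ψ (e ∷ G) * 1) U) S ⟩
  2 * ∑ (λ G → ∑ (λ e → ψ (e ∷ G) * 1) U) S
    -- The constant weight 1 counts deletions of arbitrary edges, whereas removal weights an edge by
    -- its incidence with v.
    ≡⟨ cong (2 *_) (sym (∑-delete ψ (heavy-↭ r m v i) (λ _ → 1) U)) ⟩
  2 * (∑ (λ H → ψ H * ∑ (λ _ → 1) H) S + ∑ (λ G → ∑ (λ e → ψ (e ∷ G) * 1) G) S)
    ≡⟨ cong (λ x → 2 * (∑ (λ H → ψ H * ∑ (λ _ → 1) H) S + x)) (∑-zero (heavy-repeated r m v i 2≤r) S) ⟩
  2 * (∑ (λ H → ψ H * ∑ (λ _ → 1) H) S + 0)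
    ≡⟨ cong (2 *_) (+-identityʳ (∑ (λ H → ψ H * ∑ (λ _ → 1) H) S)) ⟩
  2 * ∑ (λ H → ψ H * ∑ (λ _ → 1) H) S
    ≡⟨ cong (2 *_) (∑-cong edges S) ⟩
  2 * ∑ (λ H → m * ψ H) S
    ≡⟨ cong (2 *_) (∑-*ˡ m ψ S) ⟩
  2 * (m * ∑ ψ S) ∎
  where
  open ≤-Reasoning
  U = allSubsets n
  S = sublists U
  ψ = heavy r m v i
  insertions : ∀ G → heavy⁻ r m v i G * (n C r) ≤ 2 * ∑ (λ e → ψ (e ∷ G) * 1) U
  insertions G = begin
    L * d * (n C r)
      ≡⟨ lem₁ L d (n C r) ⟩
    d * (L * (n C r))
      ≤⟨ *-monoʳ-≤ d (lower-free-count r m sparse G) ⟩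
    d * (2 * (L * ∑ free U))
      ≡⟨ lem₂ d L (∑ free U) ⟩
    2 * (L * d * ∑ free U)
      ≡⟨ cong (2 *_) (sym (∑-*ˡ (L * d) free U)) ⟩
    2 * ∑ (λ e → L * d * free e) U
      ≤⟨ *-monoʳ-≤ 2 (∑-mono step U) ⟩
    2 * ∑ (λ e → ψ (e ∷ G) * 1) U ∎
    where
    L = 𝟙 (inL⁻ᵇ r m G)
    d = 𝟙 (i ≤ᵇ degree v G)
    free : Subset n → ℕ
    free e = 𝟙 (sizeᵇ r e) * 𝟙 (allᵇ (meetᵇ e) G)
    lem₁ : ∀ a b c → a * b * c ≡ b * (a * c)
    lem₁ = solve-∀
    lem₂ : ∀ a b c → a * (2 * (b * c)) ≡ 2 * (b * a * c)
    lem₂ = solve-∀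
    lem₃ : ∀ a b c → a * b * c ≡ a * c * b
    lem₃ = solve-∀
    step : ∀ e → L * d * free e ≤ ψ (e ∷ G) * 1
    step e = begin
      L * d * free e
        ≡⟨ lem₃ L d (free e) ⟩
      L * free e * d
        ≡⟨ cong (_* d) (sym (𝟙-inLᵇ-∷ r m e G)) ⟩
      𝟙 (inLᵇ r m (e ∷ G)) * d
        -- Insertion never lowers the degree of v, so the threshold i survives whatever e is.
        ≤⟨ *-monoʳ-≤ (𝟙 (inLᵇ r m (e ∷ G)))
             (≤ᵇ-mono i (≤-trans (m≤n+m _ (𝟙 (lookup e v))) (≤-reflexive (sym (degree-∷ v e G))))) ⟩
      ψ (e ∷ G)
        ≡⟨ sym (*-identityʳ _) ⟩
      ψ (e ∷ G) * 1 ∎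
  edges : ∀ H → ψ H * ∑ (λ _ → 1) H ≡ m * ψ H
  edges H rewrite sym (length-∑ H) = size H
    where
    size : ∀ H → ψ H * length H ≡ m * ψ H
    size H with uniformᵇ r H | length H ≡ᵇ m in len
    ... | false | _     = sym (*-zeroʳ m)
    ... | true  | false = sym (*-zeroʳ m)
    ... | true  | true rewrite ≡ᵇ⇒≡ (length H) m (subst Bool.T (sym len) _) = *-comm _ m

-- Rational bounds on the exponential

-- A quotient `z / suc q` is `fromℚᵘ (mkℚᵘ z q)` by definition. Passing to unnormalised fractions
-- reduces comparisons to cross-multiplication of integers.
fromℚᵘ-mono-≤ : ∀ {p q} → p ℚᵘ.≤ q → fromℚᵘ p ℚ.≤ fromℚᵘ q
fromℚᵘ-mono-≤ {p} {q} p≤q = ℚ.toℚᵘ-cancel-≤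
  (ℚᵘ.≤-respˡ-≃ (ℚᵘ.≃-sym (ℚ.toℚᵘ-fromℚᵘ p)) (ℚᵘ.≤-respʳ-≃ (ℚᵘ.≃-sym (ℚ.toℚᵘ-fromℚᵘ q)) p≤q))

fromℚᵘ-mono-< : ∀ {p q} → p ℚᵘ.< q → fromℚᵘ p ℚ.< fromℚᵘ q
fromℚᵘ-mono-< {p} {q} p<q = ℚ.toℚᵘ-cancel-<
  (ℚᵘ.<-respˡ-≃ (ℚᵘ.≃-sym (ℚ.toℚᵘ-fromℚᵘ p)) (ℚᵘ.<-respʳ-≃ (ℚᵘ.≃-sym (ℚ.toℚᵘ-fromℚᵘ q)) p<q))

fromℚᵘ-homo-* : ∀ p q → fromℚᵘ (p ℚᵘ.* q) ≡ fromℚᵘ p ℚ.* fromℚᵘ q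
fromℚᵘ-homo-* p q = ℚ.toℚᵘ-injective (ℚᵘ.≃-trans (ℚ.toℚᵘ-fromℚᵘ (p ℚᵘ.* q)) (ℚᵘ.≃-sym
  (ℚᵘ.≃-trans (ℚ.toℚᵘ-homo-* (fromℚᵘ p) (fromℚᵘ q))
    (ℚᵘ.*-cong (ℚ.toℚᵘ-fromℚᵘ p) (ℚ.toℚᵘ-fromℚᵘ q)))))

fromℚᵘ-homo-+ : ∀ p q → fromℚᵘ (p ℚᵘ.+ q) ≡ fromℚᵘ p ℚ.+ fromℚᵘ q
fromℚᵘ-homo-+ p q = ℚ.toℚᵘ-injective (ℚᵘ.≃-trans (ℚ.toℚᵘ-fromℚᵘ (p ℚᵘ.+ q)) (ℚᵘ.≃-sym
  (ℚᵘ.≃-trans (ℚ.toℚᵘ-homo-+ (fromℚᵘ p) (fromℚᵘ q))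
    (ℚᵘ.+-cong (ℚ.toℚᵘ-fromℚᵘ p) (ℚ.toℚᵘ-fromℚᵘ q)))))

ℤtoℚ-mono-≤ : ∀ {y z} → y ℤ.≤ z → ℤtoℚ y ℚ.≤ ℤtoℚ z
ℤtoℚ-mono-≤ {y} {z} y≤z = fromℚᵘ-mono-≤ {mkℚᵘ y 0} {mkℚᵘ z 0} (*≤* (ℤ.*-monoʳ-≤-nonNeg (pos 1) y≤z))

ℕtoℚ-mono-< : ∀ {a b} → a < b → ℕtoℚ a ℚ.< ℕtoℚ b
ℕtoℚ-mono-< {a} {b} a<b = fromℚᵘ-mono-< {mkℚᵘ (pos a) 0} {mkℚᵘ (pos b) 0} (*<* (ℤ.*-monoʳ-<-pos (pos 1) (ℤ.+<+ a<b)))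

ℕtoℚ-homo-+ : ∀ a b → ℕtoℚ (a + b) ≡ ℕtoℚ a ℚ.+ ℕtoℚ b
ℕtoℚ-homo-+ a b = ≡.trans (cong ℤtoℚ (sym (cong₂ ℤ._+_ (ℤ.*-identityʳ (pos a)) (ℤ.*-identityʳ (pos b)))))
  (fromℚᵘ-homo-+ (mkℚᵘ (pos a) 0) (mkℚᵘ (pos b) 0))

ℕtoℚ-homo-* : ∀ a b → ℕtoℚ (a * b) ≡ ℕtoℚ a ℚ.* ℕtoℚ b
ℕtoℚ-homo-* a b = ≡.trans (cong ℤtoℚ (ℤ.pos-* a b)) (fromℚᵘ-homo-* (mkℚᵘ (pos a) 0) (mkℚᵘ (pos b) 0))

ℕtoℚ-homo-^ : ∀ a k → ℕtoℚ (a ^ k) ≡ ℕtoℚ a ^ℚ k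
ℕtoℚ-homo-^ a zero    = ≡.refl
ℕtoℚ-homo-^ a (suc k) = ≡.trans (ℕtoℚ-homo-* a (a ^ k)) (cong (ℕtoℚ a ℚ.*_) (ℕtoℚ-homo-^ a k))

frac-nonNeg : ∀ p q → 0ℚ ℚ.≤ frac p q
frac-nonNeg p zero    = ℚ.≤-refl
frac-nonNeg p (suc q) = fromℚᵘ-mono-≤ {mkℚᵘ (pos 0) 0} {mkℚᵘ (pos p) q}
  (*≤* (subst₂ ℤ._≤_ (sym (ℤ.*-zeroˡ (pos (suc q)))) (sym (ℤ.*-identityʳ (pos p))) (ℤ.+≤+ z≤n)))

≤-frac : ∀ k p q .{{_ : NonZero q}} → k * q ≤ p → ℕtoℚ k ℚ.≤ frac p q
≤-frac k p (suc q) k*q≤p = fromℚᵘ-mono-≤ {mkℚᵘ (pos k) 0} {mkℚᵘ (pos p) q}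
  (*≤* (subst₂ ℤ._≤_ (ℤ.pos-* k (suc q)) (sym (ℤ.*-identityʳ (pos p))) (ℤ.+≤+ k*q≤p)))

<-frac-* : ∀ k p q l .{{_ : NonZero q}} → k * q < p * l → ℕtoℚ k ℚ.< frac p q ℚ.* ℕtoℚ l
<-frac-* k p (suc q) l kq<pl = subst (ℕtoℚ k ℚ.<_) (fromℚᵘ-homo-* (mkℚᵘ (pos p) q) (mkℚᵘ (pos l) 0))
  (fromℚᵘ-mono-< {mkℚᵘ (pos k) 0} {mkℚᵘ (pos p) q ℚᵘ.* mkℚᵘ (pos l) 0} (*<* (subst₂ ℤ._<_
    (≡.trans (ℤ.pos-* k (suc q)) (cong (λ d → pos k ℤ.* pos d) (sym (*-identityʳ (suc q)))))
    (≡.trans (ℤ.pos-* p l) (sym (ℤ.*-identityʳ (pos p ℤ.* pos l)))) (ℤ.+<+ kq<pl))))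

ℕtoℚ-nonNeg : ∀ a → 0ℚ ℚ.≤ ℕtoℚ a
ℕtoℚ-nonNeg a = ℤtoℚ-mono-≤ {pos 0} {pos a} (ℤ.+≤+ z≤n)

^ℚ-nonNeg : ∀ {x} k → 0ℚ ℚ.≤ x → 0ℚ ℚ.≤ x ^ℚ k
^ℚ-nonNeg zero    0≤x = ℕtoℚ-nonNeg 1
^ℚ-nonNeg {x} (suc k) 0≤x = ℚ.≤-trans (ℚ.≤-reflexive (sym (ℚ.*-zeroʳ x)))
  (ℚ.*-monoˡ-≤-nonNeg x {{ℚ.nonNegative 0≤x}} (^ℚ-nonNeg k 0≤x))

^ℚ-mono-≤ : ∀ {x y} k → 0ℚ ℚ.≤ x → x ℚ.≤ y → x ^ℚ k ℚ.≤ y ^ℚ k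
^ℚ-mono-≤ zero    0≤x x≤y = ℚ.≤-refl
^ℚ-mono-≤ {x} {y} (suc k) 0≤x x≤y = ℚ.≤-trans
  (ℚ.*-monoˡ-≤-nonNeg x {{ℚ.nonNegative 0≤x}} (^ℚ-mono-≤ k 0≤x x≤y))
  (ℚ.*-monoʳ-≤-nonNeg (y ^ℚ k) {{ℚ.nonNegative (^ℚ-nonNeg k (ℚ.≤-trans 0≤x x≤y))}} x≤y)

-- Since z − x/n ≤ S, the bound (N/(N−S))^N < p/q with N = S + P certifies e^(z − x/n) < p/q.
expLt-intro : ∀ p q S P J x n z .{{_ : NonZero q}} .{{_ : NonZero n}} .{{_ : NonZero P}} →
  z ℤ.≤ pos (S + J) → J * n ≤ x → (S + P) ^ (S + P) * q < p * P ^ (S + P) →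
  ExpLt (ℤtoℚ z ℚ.- frac x n) (frac p q)
expLt-intro p q S P@(suc _) J x n z z≤S+J Jn≤x bound =
  -- Here N = S + P. From t ≤ S and P ≥ 1 follow t < N and N - t ≥ P, so P may replace N - t in the
  -- bound.
  S + P , m≤n⇒m≤o+n S (s≤s z≤n) ,
  ℚ.≤-<-trans t≤S (ℕtoℚ-mono-< (m<m+n S (s≤s z≤n))) ,
  ℚ.<-≤-trans
    (subst (ℚ._< a ℚ.* ℕtoℚ (P ^ (S + P))) (ℕtoℚ-homo-^ (S + P) (S + P))
      (<-frac-* ((S + P) ^ (S + P)) p q (P ^ (S + P)) bound))
    (ℚ.*-monoˡ-≤-nonNeg a {{ℚ.nonNegative (frac-nonNeg p q)}}
      (ℚ.≤-trans (ℚ.≤-reflexive (ℕtoℚ-homo-^ P (S + P))) (^ℚ-mono-≤ (S + P) (ℕtoℚ-nonNeg P) P≤N-t)))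
  where
  a = frac p q
  b = frac x n
  t = ℤtoℚ z ℚ.- b
  cancel : ∀ u w → (u ℚ.+ w) ℚ.- w ≡ u
  cancel u w = ≡.trans (ℚ.+-assoc u w (ℚ.- w)) (≡.trans (cong (u ℚ.+_) (ℚ.+-inverseʳ w)) (ℚ.+-identityʳ u))
  t≤S : t ℚ.≤ ℕtoℚ S
  t≤S = ℚ.≤-trans (ℚ.+-mono-≤ (ℤtoℚ-mono-≤ z≤S+J) (ℚ.neg-antimono-≤ (≤-frac J x n Jn≤x)))
    (ℚ.≤-reflexive (≡.trans (cong (ℚ._- ℕtoℚ J) (ℕtoℚ-homo-+ S J)) (cancel (ℕtoℚ S) (ℕtoℚ J))))
  P≤N-t : ℕtoℚ P ℚ.≤ ℕtoℚ (S + P) ℚ.- t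
  P≤N-t = ℚ.≤-trans
    (ℚ.≤-reflexive (sym (≡.trans
      (cong (ℚ._- ℕtoℚ S) (≡.trans (cong ℕtoℚ (+-comm S P)) (ℕtoℚ-homo-+ P S)))
      (cancel (ℕtoℚ P) (ℕtoℚ S)))))
    (ℚ.+-monoʳ-≤ (ℕtoℚ (S + P)) (ℚ.neg-antimono-≤ t≤S))

^-distribʳ-* : ∀ a b k → (a * b) ^ k ≡ a ^ k * b ^ k
^-distribʳ-* a b zero    = ≡.refl
^-distribʳ-* a b (suc k) = ≡.trans (cong (a * b *_) (^-distribʳ-* a b k)) (*-interchange a b (a ^ k) (b ^ k))

t+3t≡4t : ∀ t → t + 3 * t ≡ 4 * t
t+3t≡4t = solve-∀

-- The bound (N/(N−T))^N at N = 4T gives p/q ≤ (4/3)^(4T), and (4/3)^16 < 100.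
ceilLog-lower : ∀ p q J x n z .{{_ : NonZero q}} .{{_ : NonZero n}} → q < p → J * n ≤ x →
  ¬ ExpLt (ℤtoℚ z ℚ.- frac x n) (frac p q) →
  ∃[ T ] (z ≡ pos (J + T) × p ^ 4 ≤ q ^ 4 * 100 ^ T)
ceilLog-lower p q J x n z q<p Jn≤x ¬exp with z ℤ.≤? pos J
-- If z ≤ J the exponent is at most 0. With S = 0 and P = 1 the certificate is just q < p, that is,
-- 1 < p/q.
... | yes z≤J = contradiction
  (expLt-intro p q 0 1 J x n z z≤J Jn≤x (subst₂ _<_ (sym (+-identityʳ q)) (sym (*-identityʳ p)) q<p))
  ¬exp
... | no z≰J = excess z ¬exp (ℤ.≰⇒> z≰J)
  where
  excess : ∀ z → ¬ ExpLt (ℤtoℚ z ℚ.- frac x n) (frac p q) → pos J ℤ.< z →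
    ∃[ T ] (z ≡ pos (J + T) × p ^ 4 ≤ q ^ 4 * 100 ^ T)
  excess (pos M) ¬exp (ℤ.+<+ J<M) with m<n⇒∃k J<M
    where
    m<n⇒∃k : ∀ {a b} → a < b → ∃[ k ] b ≡ a + suc k
    m<n⇒∃k {a} {b} a<b = b ∸ suc a , sym (≡.trans (+-suc a _) (m+[n∸m]≡n a<b))
  ... | k , ≡.refl = suc k , ≡.refl , *-cancelʳ-≤ _ _ (3 ^ (16 * T)) {{m^n≢0 3 (16 * T)}} fourth-power
    where
    open ≤-Reasoning
    T = suc k
    N = 4 * T
    base : p * 3 ^ N ≤ q * 4 ^ N
    -- The exponent is at most T, so S = T; then P = 3T makes N/(N - T) equal to 4/3 for every T,
    -- and the common factor T^N cancels.
    base = ≮⇒≥ λ lt → ¬exp (expLt-intro p q T (3 * T) J x n (pos (J + T))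
      (ℤ.+≤+ (≤-reflexive (+-comm J T))) Jn≤x (scaled lt))
      where
      scaled : q * 4 ^ N < p * 3 ^ N → (T + 3 * T) ^ (T + 3 * T) * q < p * (3 * T) ^ (T + 3 * T)
      scaled lt rewrite t+3t≡4t T | ^-distribʳ-* 4 T (4 * T) | ^-distribʳ-* 3 T (4 * T) =
        subst₂ _<_ (lem₁ q (4 ^ N) (T ^ N)) (*-assoc p (3 ^ N) (T ^ N))
          (*-monoˡ-< (T ^ N) {{m^n≢0 T N}} lt)
        where
        lem₁ : ∀ a b c → a * b * c ≡ b * c * a
        lem₁ = solve-∀
    N*4 : N * 4 ≡ 16 * T
    N*4 = lem T
      where
      lem : ∀ t → 4 * t * 4 ≡ 16 * t
      lem = solve-∀
    fourth-power : p ^ 4 * 3 ^ (16 * T) ≤ q ^ 4 * 100 ^ T * 3 ^ (16 * T)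
    fourth-power = begin
      p ^ 4 * 3 ^ (16 * T)              ≡⟨ cong (p ^ 4 *_) (≡.trans (cong (3 ^_) (sym N*4)) (sym (^-*-assoc 3 N 4))) ⟩
      p ^ 4 * (3 ^ N) ^ 4               ≡⟨ sym (^-distribʳ-* p (3 ^ N) 4) ⟩
      (p * 3 ^ N) ^ 4                   ≤⟨ ^-monoˡ-≤ 4 base ⟩
      (q * 4 ^ N) ^ 4                   ≡⟨ ^-distribʳ-* q (4 ^ N) 4 ⟩
      q ^ 4 * (4 ^ N) ^ 4               ≡⟨ cong (q ^ 4 *_) (≡.trans (^-*-assoc 4 N 4) (cong (4 ^_) N*4)) ⟩
      q ^ 4 * 4 ^ (16 * T)              ≡⟨ cong (q ^ 4 *_) (sym (^-*-assoc 4 16 T)) ⟩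
      -- The numerical comparison is 4294967296 ≤ 4304672100.
      q ^ 4 * (4 ^ 16) ^ T              ≤⟨ *-monoʳ-≤ (q ^ 4) (^-monoˡ-≤ T (≤ᵇ⇒≤ (4 ^ 16) (100 * 3 ^ 16) _)) ⟩
      q ^ 4 * (100 * 3 ^ 16) ^ T        ≡⟨ cong (q ^ 4 *_) (^-distribʳ-* 100 (3 ^ 16) T) ⟩
      q ^ 4 * (100 ^ T * (3 ^ 16) ^ T)  ≡⟨ cong (λ y → q ^ 4 * (100 ^ T * y)) (^-*-assoc 3 16 T) ⟩
      q ^ 4 * (100 ^ T * 3 ^ (16 * T))  ≡⟨ sym (*-assoc (q ^ 4) (100 ^ T) _) ⟩
      q ^ 4 * 100 ^ T * 3 ^ (16 * T)    ∎

-- Degree tails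

-- `absorption` trades n times the number of r-sets through v for r times `n C r`, which is the
-- factor on the left of the insertion bound; the binomial thus disappears without a division.
heavy-ratio : ∀ r m (v : Fin n) i → 2 ≤ r → 2 * (m * (pairs r * through₂ n r)) ≤ n C r →
  suc i * n * numHeavy r m v (suc i) ≤ 2 * (r * m) * numHeavy r m v i
heavy-ratio {suc n} r@(suc k) m v i 2≤r sparse = begin
  suc i * suc n * A′           ≡⟨ lem₁ (suc i) (suc n) A′ ⟩
  suc n * (suc i * A′)         ≤⟨ *-monoʳ-≤ (suc n) (heavy-edge-removal r m v i) ⟩
  suc n * (L * (n C k))        ≡⟨ *-left-comm (suc n) L (n C k) ⟩
  L * (suc n * (n C k))        ≡⟨ cong (L *_) (absorption n k) ⟩
  L * (r * (suc n C r))        ≡⟨ *-left-comm L r (suc n C r) ⟩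
  r * (L * (suc n C r))        ≤⟨ *-monoʳ-≤ r (heavy-edge-insertion r m v i 2≤r sparse) ⟩
  r * (2 * (m * A₀))           ≡⟨ lem₂ r m A₀ ⟩
  2 * (r * m) * A₀             ∎
  where
  open ≤-Reasoning
  A′ = numHeavy r m v (suc i)
  A₀ = numHeavy r m v i
  L = numHeavy⁻ r m v i
  lem₁ : ∀ a b c → a * b * c ≡ b * (a * c)
  lem₁ = solve-∀
  lem₂ : ∀ a b c → a * (2 * (b * c)) ≡ 2 * (a * b) * c
  lem₂ = solve-∀

pairs-double : ∀ k → 2 * pairs k + k ≡ k * k
pairs-double zero    = ≡.refl
pairs-double (suc k) = begin
  2 * (k + pairs k) + suc k       ≡⟨ lem₁ k (pairs k) ⟩
  2 * pairs k + k + (k + k + 1)   ≡⟨ cong (_+ (k + k + 1)) (pairs-double k) ⟩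
  k * k + (k + k + 1)             ≡⟨ lem₂ k ⟩
  suc k * suc k                   ∎
  where
  open ≡-Reasoning
  lem₁ : ∀ k p → 2 * (k + p) + suc k ≡ 2 * p + k + (k + k + 1)
  lem₁ = solve-∀
  lem₂ : ∀ k → k * k + (k + k + 1) ≡ suc k * suc k
  lem₂ = solve-∀

through₂-absorption : ∀ p q →
  suc (suc p) * suc p * (p C q) ≡ suc q * suc (suc q) * (suc (suc p) C suc (suc q))
through₂-absorption p q = begin
  suc (suc p) * suc p * (p C q)               ≡⟨ *-assoc (suc (suc p)) (suc p) _ ⟩
  suc (suc p) * (suc p * (p C q))             ≡⟨ cong (suc (suc p) *_) (absorption p q) ⟩
  suc (suc p) * (suc q * (suc p C suc q))     ≡⟨ *-left-comm (suc (suc p)) (suc q) (suc p C suc q) ⟩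
  suc q * (suc (suc p) * (suc p C suc q))     ≡⟨ cong (suc q *_) (absorption (suc p) (suc q)) ⟩
  suc q * (suc (suc q) * (suc (suc p) C suc (suc q))) ≡⟨ sym (*-assoc (suc q) (suc (suc q)) (suc (suc p) C suc (suc q))) ⟩
  suc q * suc (suc q) * (suc (suc p) C suc (suc q)) ∎
  where
  open ≡-Reasoning

-- The r-sets through two given points form a fraction r(r-1)/(n(n-1)) of all, and an edge has at
-- most r²/2 pairs; m edges therefore block at most a fraction m r⁴/(2n(n-1)).
few-blocked : ∀ n r m → 2 ≤ n → 2 ≤ r → m * r ^ 4 ≤ n * (n ∸ 1) →
  2 * (m * (pairs r * through₂ n r)) ≤ n C r
few-blocked n@(suc (suc p)) r@(suc (suc q)) m (s≤s (s≤s _)) (s≤s (s≤s _)) mr⁴≤ =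
  *-cancelˡ-≤ (n * suc p) (begin
  n * suc p * (2 * (m * (pairs r * (p C q))))     ≡⟨ lem₁ (n * suc p) m (pairs r) (p C q) ⟩
  m * (2 * pairs r) * (n * suc p * (p C q))       ≡⟨ cong (m * (2 * pairs r) *_) (through₂-absorption p q) ⟩
  m * (2 * pairs r) * (suc q * r * (n C r))       ≤⟨ *-mono-≤ (*-monoʳ-≤ m 2pairs≤r²)
                                                      (*-monoˡ-≤ (n C r) (*-monoˡ-≤ r (n≤1+n (suc q)))) ⟩
  m * (r * r) * (r * r * (n C r))                 ≡⟨ lem₂ m r (n C r) ⟩
  m * r ^ 4 * (n C r)                             ≤⟨ *-monoˡ-≤ (n C r) mr⁴≤ ⟩
  n * suc p * (n C r)                             ∎)
  where
  open ≤-Reasoning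
  2pairs≤r² : 2 * pairs r ≤ r * r
  2pairs≤r² = ≤-trans (m≤m+n (2 * pairs r) r) (≤-reflexive (pairs-double r))
  lem₁ : ∀ a b c d → a * (2 * (b * (c * d))) ≡ b * (2 * c) * (a * d)
  lem₁ = solve-∀
  lem₂ : ∀ a b c → a * (b * b) * (b * b * c) ≡ a * (b * (b * (b * (b * 1)))) * c
  lem₂ = solve-∀

square-cancel-≤ : ∀ {a b} → a * a ≤ b * b → a ≤ b
square-cancel-≤ a²≤b² = ≮⇒≥ (λ b<a → <⇒≱ (*-mono-< b<a b<a) a²≤b²)

-- Consequences of the two bounds on m

module Growth (n r m : ℕ) (2≤n : 2 ≤ n) (n≤r²m : n ≤ r * r * m) (sparse : (2 * m * r ^ 3) ^ 2 ≤ n ^ 3) where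
  open ≤-Reasoning
  private instance
    n≢0 : NonZero n
    n≢0 = >-nonZero (≤-trans (s≤s z≤n) 2≤n)

  -- The lower bound m ≥ n/r² and the upper bound m ≤ n^(3/2)/(2r³) are compatible only if 2r ≤ √n.
  -- This also yields r² < n, so that the logarithm is positive.
  4r²≤n : 4 * (r * r) ≤ n
  4r²≤n = *-cancelʳ-≤ (4 * (r * r)) n (n * n) {{m*n≢0 n n}} (begin
    4 * (r * r) * (n * n)                     ≤⟨ *-monoʳ-≤ (4 * (r * r)) (*-mono-≤ n≤r²m n≤r²m) ⟩
    4 * (r * r) * (r * r * m * (r * r * m))   ≡⟨ lem₁ r m ⟩
    (2 * m * r ^ 3) ^ 2                       ≤⟨ sparse ⟩
    n ^ 3                                     ≡⟨ lem₂ n ⟩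
    n * (n * n)                               ∎)
    where
    lem₁ : ∀ r m → 4 * (r * r) * (r * r * m * (r * r * m)) ≡
      2 * m * (r * (r * (r * 1))) * (2 * m * (r * (r * (r * 1))) * 1)
    lem₁ = solve-∀
    lem₂ : ∀ n → n * (n * (n * 1)) ≡ n * (n * n)
    lem₂ = solve-∀

  -- The product of 4r² ≤ n with the squared upper bound on m; squares avoid the half-integral
  -- exponent.
  4mr⁴≤n² : 4 * (m * r ^ 4) ≤ n * n
  4mr⁴≤n² = square-cancel-≤ (begin
    4 * (m * r ^ 4) * (4 * (m * r ^ 4))   ≡⟨ lem₁ r m ⟩
    4 * (r * r) * (2 * m * r ^ 3) ^ 2     ≤⟨ *-mono-≤ 4r²≤n sparse ⟩
    n * n ^ 3                             ≡⟨ lem₂ n ⟩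
    n * n * (n * n)                       ∎)
    where
    lem₁ : ∀ r m → 4 * (m * (r * (r * (r * (r * 1))))) * (4 * (m * (r * (r * (r * (r * 1)))))) ≡
      4 * (r * r) * (2 * m * (r * (r * (r * 1))) * (2 * m * (r * (r * (r * 1))) * 1))
    lem₁ = solve-∀
    lem₂ : ∀ n → n * (n * (n * (n * 1))) ≡ n * n * (n * n)
    lem₂ = solve-∀

  -- The slack 4 pays for n² against n(n-1), as n ≤ 2(n-1) once n ≥ 2.
  mr⁴≤n[n-1] : m * r ^ 4 ≤ n * (n ∸ 1)
  mr⁴≤n[n-1] = *-cancelˡ-≤ 4 (≤-trans 4mr⁴≤n² (lem 2≤n))
    where
    lem : ∀ {n} → 2 ≤ n → n * n ≤ 4 * (n * (n ∸ 1))
    lem {suc (suc p)} (s≤s (s≤s _)) = ≤-trans (m≤m+n _ _) (≤-reflexive (expand p))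
      where
      expand : ∀ p → suc (suc p) * suc (suc p) + (3 * p * p + 8 * p + 4) ≡ 4 * (suc (suc p) * suc p)
      expand = solve-∀

step-ratio : ∀ {r m n i a b} .{{_ : NonZero (r * m)}} → 79 * (r * r * m) ≤ suc i * n →
  suc i * n * a ≤ 2 * (r * m) * b → 79 * r * a ≤ 2 * b
step-ratio {r} {m} {n} {i} {a} {b} large ratio = *-cancelˡ-≤ (r * m) (begin
  r * m * (79 * r * a)        ≡⟨ lem₁ r m a ⟩
  79 * (r * r * m) * a        ≤⟨ *-monoˡ-≤ a large ⟩
  suc i * n * a               ≤⟨ ratio ⟩
  2 * (r * m) * b             ≡⟨ lem₂ (r * m) b ⟩
  r * m * (2 * b)             ∎)
  where
  open ≤-Reasoning
  lem₁ : ∀ r m a → r * m * (79 * r * a) ≡ 79 * (r * r * m) * a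
  lem₁ = solve-∀
  lem₂ : ∀ x b → 2 * x * b ≡ x * (2 * b)
  lem₂ = solve-∀

-- Geometric decay

geometric : ∀ (a : ℕ → ℕ) q J → (∀ i → J ≤ i → q * a (suc i) ≤ a i) → ∀ t → q ^ t * a (J + t) ≤ a J
geometric a q J step zero    = ≤-reflexive (≡.trans (+-identityʳ _) (cong a (+-identityʳ J)))
geometric a q J step (suc t) = begin
  q * q ^ t * a (J + suc t)       ≡⟨ cong (λ j → q * q ^ t * a j) (+-suc J t) ⟩
  q * q ^ t * a (suc (J + t))     ≡⟨ lem q (q ^ t) _ ⟩
  q ^ t * (q * a (suc (J + t)))   ≤⟨ *-monoʳ-≤ (q ^ t) (step (J + t) (m≤m+n J t)) ⟩
  q ^ t * a (J + t)               ≤⟨ geometric a q J step t ⟩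
  a J                             ∎
  where
  open ≤-Reasoning
  lem : ∀ a b c → a * b * c ≡ b * (a * c)
  lem = solve-∀

-- The two steps from J to 2 + J use rate r, the remaining T + 1 use rate 100.
tail-bound : ∀ (a : ℕ → ℕ) p r J T .{{_ : NonZero r}} →
  (∀ i → J ≤ i → r * a (suc i) ≤ a i) → (∀ i → J ≤ i → 100 * a (suc i) ≤ a i) →
  p ^ 4 ≤ (r * r) ^ 4 * 100 ^ T → p ^ 4 * a (suc (2 + J + T)) ≤ r ^ 6 * a J
-- An auxiliary factor r² is consumed by the two rate-r steps and cancels at the end through r⁸ = r²
-- r⁶.
tail-bound a p r J T rate-r rate-100 p⁴≤ = *-cancelˡ-≤ (r * r) {{m*n≢0 r r}} (begin
  r * r * (p ^ 4 * x)                       ≤⟨ *-monoʳ-≤ (r * r) (*-monoˡ-≤ x p⁴≤) ⟩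
  r * r * ((r * r) ^ 4 * 100 ^ T * x)       ≡⟨ lem₁ (r * r) ((r * r) ^ 4) (100 ^ T) x ⟩
  (r * r) ^ 4 * (r * r * (100 ^ T * x))     ≤⟨ *-monoʳ-≤ ((r * r) ^ 4) (begin
      r * r * (100 ^ T * x)                 ≤⟨ *-monoʳ-≤ (r * r) (*-monoˡ-≤ x (^-monoʳ-≤ 100 (n≤1+n T))) ⟩
      r * r * (100 ^ suc T * x)             ≡⟨ cong (λ j → r * r * (100 ^ suc T * a j)) (sym (+-suc (2 + J) T)) ⟩
      r * r * (100 ^ suc T * a (2 + J + suc T)) ≤⟨ *-monoʳ-≤ (r * r) (geometric a 100 (2 + J)
                                                   (λ i J≤i → rate-100 i (≤-trans (m≤n+m J 2) J≤i)) (suc T)) ⟩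
      r * r * a (2 + J)                     ≡⟨ *-assoc r r _ ⟩
      r * (r * a (2 + J))                   ≤⟨ *-monoʳ-≤ r (rate-r (suc J) (n≤1+n J)) ⟩
      r * a (suc J)                         ≤⟨ rate-r J ≤-refl ⟩
      a J                                   ∎) ⟩
  (r * r) ^ 4 * a J                         ≡⟨ lem₂ r (a J) ⟩
  r * r * (r ^ 6 * a J)                     ∎)
  where
  open ≤-Reasoning
  x = a (suc (2 + J + T))
  lem₁ : ∀ a b c d → a * (b * c * d) ≡ b * (a * (c * d))
  lem₁ = solve-∀
  lem₂ : ∀ r y → r * r * (r * r * (r * r * (r * r * 1))) * y ≡ r * r * (r * (r * (r * (r * (r * (r * 1))))) * y)
  lem₂ = solve-∀

-- Union bound over the vertices

numL-∑ : ∀ r n m → numL r n m ≡ ∑ (λ H → 𝟙 (inLᵇ r m H)) (sublists (allSubsets n))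
numL-∑ r n m = length-filterᵇ (inLᵇ r m) (sublists (allSubsets n))

numHeavy≤numL : ∀ r m (v : Fin n) j → numHeavy r m v j ≤ numL r n m
numHeavy≤numL {n} r m v j = ≤-trans
  (∑-mono (λ H → ≤-trans (*-monoʳ-≤ (𝟙 (inLᵇ r m H)) (𝟙≤1 (j ≤ᵇ degree v H)))
                         (≤-reflexive (*-identityʳ (𝟙 (inLᵇ r m H))))) (sublists (allSubsets n)))
  (≤-reflexive (sym (numL-∑ r n m)))

union-bound : ∀ r n m M →
  numL r n m ∸ numC r n m (pos M) ≤ ∑ (λ v → numHeavy r m v (suc M)) (allFin n)
union-bound r n m M = m≤n+o⇒m∸n≤o (numL r n m) (numC r n m (pos M)) (begin
  numL r n m
    ≡⟨ numL-∑ r n m ⟩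
  ∑ L S
    ≤⟨ ∑-mono pointwise S ⟩
  ∑ (λ H → L H * 𝟙 (maxDegreeAtMostᵇ (pos M) H) + ∑ (λ v → heavy r m v (suc M) H) (allFin n)) S
    ≡⟨ ∑-distrib-+ (λ H → L H * 𝟙 (maxDegreeAtMostᵇ (pos M) H)) _ S ⟩
  ∑ (λ H → L H * 𝟙 (maxDegreeAtMostᵇ (pos M) H)) S + ∑ (λ H → ∑ (λ v → heavy r m v (suc M) H) (allFin n)) S
    ≡⟨ cong₂ _+_ (sym numC-∑) (∑-swap (λ H v → heavy r m v (suc M) H) S (allFin n)) ⟩
  numC r n m (pos M) + ∑ (λ v → numHeavy r m v (suc M)) (allFin n) ∎)
  where
  open ≤-Reasoning
  S = sublists (allSubsets n)
  L : List (Subset n) → ℕ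
  L H = 𝟙 (inLᵇ r m H)
  numC-∑ : numC r n m (pos M) ≡ ∑ (λ H → L H * 𝟙 (maxDegreeAtMostᵇ (pos M) H)) S
  numC-∑ = ≡.trans (length-filterᵇ (maxDegreeAtMostᵇ (pos M)) (LinearGraphs r n m))
    (∑-filterᵇ (inLᵇ r m) (λ H → 𝟙 (maxDegreeAtMostᵇ (pos M) H)) S)
  light-or-heavy : ∀ (d : Fin n → ℕ) vs →
    1 ≤ 𝟙 (allᵇ (λ v → pos (d v) ℤ.≤ᵇ (pos M)) vs) + ∑ (λ v → 𝟙 (suc M ≤ᵇ d v)) vs
  light-or-heavy d []       = ≤-refl
  light-or-heavy d (v ∷ vs) with d v ≤ᵇ M in eq
  ... | false with suc M ≤ᵇ d v | ≤⇒≤ᵇ {suc M} {d v} (≰⇒> λ d≤M → subst Bool.T eq (≤⇒≤ᵇ d≤M))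
  ...   | true | _ = s≤s z≤n
  light-or-heavy d (v ∷ vs) | true = ≤-trans (light-or-heavy d vs)
    (+-monoʳ-≤ (𝟙 (allᵇ (λ v → pos (d v) ℤ.≤ᵇ (pos M)) vs)) (m≤n+m _ (𝟙 (suc M ≤ᵇ d v))))
  pointwise : ∀ H → L H ≤ L H * 𝟙 (maxDegreeAtMostᵇ (pos M) H) + ∑ (λ v → heavy r m v (suc M) H) (allFin n)
  pointwise H = begin
    L H
      ≡⟨ sym (*-identityʳ (L H)) ⟩
    L H * 1
      ≤⟨ *-monoʳ-≤ (L H) (light-or-heavy (λ v → degree v H) (allFin n)) ⟩
    L H * (𝟙 (maxDegreeAtMostᵇ (pos M) H) + ∑ (λ v → 𝟙 (suc M ≤ᵇ degree v H)) (allFin n))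
      ≡⟨ *-distribˡ-+ (L H) (𝟙 (maxDegreeAtMostᵇ (pos M) H)) _ ⟩
    L H * 𝟙 (maxDegreeAtMostᵇ (pos M) H) + L H * ∑ (λ v → 𝟙 (suc M ≤ᵇ degree v H)) (allFin n)
      ≡⟨ cong (L H * 𝟙 (maxDegreeAtMostᵇ (pos M) H) +_) (sym (∑-*ˡ (L H) _ (allFin n))) ⟩
    L H * 𝟙 (maxDegreeAtMostᵇ (pos M) H) + ∑ (λ v → heavy r m v (suc M) H) (allFin n) ∎

heavy-bound : ∀ n r m z → 2 ≤ n → 3 ≤ r → n ≤ r * r * m → (2 * m * r ^ 3) ^ 2 ≤ n ^ 3 →
  IsCeilLogPlus (frac n (r * r)) (frac (81 * r * r * m) n) z →
  ∃[ M ] (z ≡ pos M × (∀ (v : Fin n) → n ^ 4 * numHeavy r m v (suc M) ≤ r ^ 6 * numL r n m))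
heavy-bound n r@(suc r′) m z 2≤n 3≤r n≤r²m sparse (_ , ¬exp) = conclude J₀ 2+J₀≡J
  where
  open Growth n r m 2≤n n≤r²m sparse
  open ≤-Reasoning
  instance
    n≢0 : NonZero n
    n≢0 = >-nonZero (≤-trans (s≤s z≤n) 2≤n)
  x = 81 * r * r * m
  x≡ : x ≡ 81 * (r * r * m)
  x≡ = lem r m
    where
    lem : ∀ r m → 81 * r * r * m ≡ 81 * (r * r * m)
    lem = solve-∀
  J = x / n
  x<[J+1]n : x < suc J * n
  x<[J+1]n = begin-strict
    x                ≡⟨ m≡m%n+[m/n]*n x n ⟩
    x % n + J * n    <⟨ +-monoˡ-< (J * n) (m%n<n x n) ⟩
    n + J * n        ∎
  -- Makes `J ∸ 2` a genuine subtraction: n ≤ r²m gives 81r²m ≥ 2n.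
  2≤J : 2 ≤ J
  2≤J = s≤s⁻¹ (*-cancelʳ-< n 2 (suc J) (begin-strict
    2 * n                ≤⟨ *-mono-≤ (s≤s (s≤s (z≤n {79}))) n≤r²m ⟩
    81 * (r * r * m)     ≡⟨ sym x≡ ⟩
    x                    <⟨ x<[J+1]n ⟩
    suc J * n            ∎))
  J₀ = J ∸ 2
  2+J₀≡J : 2 + J₀ ≡ J
  2+J₀≡J = m+[n∸m]≡n 2≤J
  m≢0 : ∀ {m} → n ≤ r * r * m → NonZero m
  m≢0 {zero}  n≤ = contradiction (≤-trans 2≤n (≤-trans n≤ (≤-reflexive (*-zeroʳ (r * r))))) λ ()
  m≢0 {suc m} _  = _
  rm≢0 : NonZero (r * m)
  rm≢0 = m*n≢0 r m {{_}} {{m≢0 n≤r²m}}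
  conclude : ∀ J₀ → 2 + J₀ ≡ J →
    ∃[ M ] (z ≡ pos M × (∀ (v : Fin n) → n ^ 4 * numHeavy r m v (suc M) ≤ r ^ 6 * numL r n m))
  conclude J₀ 2+J₀≡J with ceilLog-lower n (r * r) J x n z {{m*n≢0 r r}} r²<n (m/n*n≤m x n) ¬exp
    where
    r²<n : r * r < n
    r²<n = <-≤-trans (subst (_< 4 * (r * r)) (*-identityˡ (r * r))
      (*-monoˡ-< (r * r) {{m*n≢0 r r}} {1} {4} (s≤s (s≤s z≤n)))) 4r²≤n
  ... | T , z≡ , n⁴≤ = 2 + J₀ + T , ≡.trans z≡ (cong (λ j → pos (j + T)) (sym 2+J₀≡J)) , bound
    where
    -- For i ≥ J - 2 one has (i+3)n ≥ (J+1)n > 81r²m, and the surplus 2n is at most 2r²m.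
    large : ∀ i → J₀ ≤ i → 79 * (r * r * m) ≤ suc i * n
    large i J₀≤i = +-cancelʳ-≤ (2 * (r * r * m)) _ _ (begin
      79 * (r * r * m) + 2 * (r * r * m)   ≡⟨ lem₁ (r * r * m) ⟩
      81 * (r * r * m)                     ≡⟨ sym x≡ ⟩
      x                                    ≤⟨ <⇒≤ x<[J+1]n ⟩
      suc J * n                            ≤⟨ *-monoˡ-≤ n (s≤s (≤-trans (≤-reflexive (sym 2+J₀≡J)) (+-monoʳ-≤ 2 J₀≤i))) ⟩
      suc (2 + i) * n                      ≡⟨ lem₂ i n ⟩
      suc i * n + 2 * n                    ≤⟨ +-monoʳ-≤ (suc i * n) (*-monoʳ-≤ 2 n≤r²m) ⟩
      suc i * n + 2 * (r * r * m)          ∎)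
      where
      lem₁ : ∀ y → 79 * y + 2 * y ≡ 81 * y
      lem₁ = solve-∀
      lem₂ : ∀ i n → suc (2 + i) * n ≡ suc i * n + 2 * n
      lem₂ = solve-∀
    bound : ∀ (v : Fin n) → n ^ 4 * numHeavy r m v (suc (2 + J₀ + T)) ≤ r ^ 6 * numL r n m
    bound v = ≤-trans (tail-bound a n r J₀ T rate-r rate-100 n⁴≤)
      (*-monoʳ-≤ (r ^ 6) (numHeavy≤numL r m v J₀))
      where
      a : ℕ → ℕ
      a = numHeavy r m v
      2≤r : 2 ≤ r
      2≤r = ≤-trans (s≤s (s≤s z≤n)) 3≤r
      rate : ∀ i → J₀ ≤ i → 79 * r * a (suc i) ≤ 2 * a i
      rate i J₀≤i = step-ratio {r} {m} {n} {i} {{rm≢0}} (large i J₀≤i)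
        (heavy-ratio r m v i 2≤r (few-blocked n r m 2≤n 2≤r mr⁴≤n[n-1]))
      weaken : ∀ q → 2 * q ≤ 79 * r → ∀ i → J₀ ≤ i → q * a (suc i) ≤ a i
      weaken q 2q≤79r i J₀≤i = *-cancelˡ-≤ 2 (begin
        2 * (q * a (suc i))   ≡⟨ sym (*-assoc 2 q _) ⟩
        2 * q * a (suc i)     ≤⟨ *-monoˡ-≤ (a (suc i)) 2q≤79r ⟩
        79 * r * a (suc i)    ≤⟨ rate i J₀≤i ⟩
        2 * a i               ∎)
      -- Both rates come from 79r/2: rate r because 2 ≤ 79, and rate 100 because r ≥ 3 gives 79r ≥
      -- 237 ≥ 200.
      rate-r : ∀ i → J₀ ≤ i → r * a (suc i) ≤ a i
      rate-r = weaken r (*-monoˡ-≤ r (s≤s (s≤s (z≤n {77}))))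
      rate-100 : ∀ i → J₀ ≤ i → 100 * a (suc i) ≤ a i
      rate-100 = weaken 100 (≤-trans (≤ᵇ⇒≤ 200 237 _) (*-monoʳ-≤ 79 3≤r))

theorem4p1 : (r m : ℕ → ℕ) (M₀ : ℕ → ℤ)
    → (∀ n → 3 ≤ r n)
    → (∀ n → n ≤ r n * r n * m n)
    → (∀ k → 1 ≤ k → ∃[ N ] (∀ n → N ≤ n → (k * m n * r n ^ 3) ^ 2 ≤ n ^ 3))
    → (∀ n → 1 ≤ n → IsCeilLogPlus (frac n (r n * r n)) (frac (81 * r n * r n * m n) n) (M₀ n))
    → ∃[ C ] ∃[ N ] (∀ n → N ≤ n →
    n ^ 3 * (numL (r n) n (m n) ∸ numC (r n) n (m n) (M₀ n))
    ≤ C * r n ^ 6 * numL (r n) n (m n))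
theorem4p1 r m M₀ 3≤r n≤r²m m=o ceil with m=o 2 (s≤s z≤n)
-- The little-o hypothesis enters through its instance k = 2, and the threshold 2 + N secures both n
-- ≥ 2 and n ≥ N. The implied constant is 1.
... | N , sparse = 1 , 2 + N , λ n 2+N≤n →
  conclude n (≤-trans (m≤m+n 2 N) 2+N≤n) (≤-trans (m≤n+m N 2) 2+N≤n)
  where
  open ≤-Reasoning
  conclude : ∀ n → 2 ≤ n → N ≤ n →
    n ^ 3 * (numL (r n) n (m n) ∸ numC (r n) n (m n) (M₀ n)) ≤ 1 * r n ^ 6 * numL (r n) n (m n)
  conclude n 2≤n N≤n
    with heavy-bound n (r n) (m n) (M₀ n) 2≤n (3≤r n) (n≤r²m n) (sparse n N≤n) (ceil n (≤-trans (s≤s z≤n) 2≤n))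
  -- The inequality is proved with an extra factor n, which the n equal bounds on the right supply.
  ... | M , M₀≡M , bound rewrite M₀≡M = *-cancelˡ-≤ n {{>-nonZero (≤-trans (s≤s z≤n) 2≤n)}} (begin
    n * (n ^ 3 * (ℓ ∸ numC (r n) n (m n) (pos M)))
      ≡⟨ sym (*-assoc n (n ^ 3) _) ⟩
    n ^ 4 * (ℓ ∸ numC (r n) n (m n) (pos M))
      ≤⟨ *-monoʳ-≤ (n ^ 4) (union-bound (r n) n (m n) M) ⟩
    n ^ 4 * ∑ (λ v → numHeavy (r n) (m n) v (suc M)) (allFin n)
      ≡⟨ sym (∑-*ˡ (n ^ 4) (λ v → numHeavy (r n) (m n) v (suc M)) (allFin n)) ⟩
    ∑ (λ v → n ^ 4 * numHeavy (r n) (m n) v (suc M)) (allFin n)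
      ≤⟨ ∑-mono bound (allFin n) ⟩
    ∑ (λ _ → r n ^ 6 * ℓ) (allFin n)
      ≡⟨ ∑-const (r n ^ 6 * ℓ) (allFin n) ⟩
    length (allFin n) * (r n ^ 6 * ℓ)
      ≡⟨ cong₂ _*_ (length-tabulate {n = n} (λ i → i)) (cong (_* ℓ) (sym (+-identityʳ (r n ^ 6)))) ⟩
    n * (1 * r n ^ 6 * ℓ) ∎)
    where
    ℓ = numL (r n) n (m n)
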